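{- Let $k\ge 2$ be a fixed integer. Suppose $G$ is a $(\mathcal{C}^{\mathrm{even}}_{2k}\cup\mathcal{C}_k)$-free graph on $n$ vertices with average degree $d\sim n^{1/k}$ (as $n\to\infty$). Then $e_G(S,T)=\frac{d}{n}|S||T|+o(n^{1+1/k})$ for any $S,T\subseteq V(G)$.
   Context: Graphs are finite and simple. $\mathcal{C}^{\mathrm{even}}_{2k}=\{C_4,C_6,\dots,C_{2k}\}$ and $\mathcal{C}_k=\{C_3,\dots,C_k\}$; a graph is $\mathcal{F}$-free if it contains no subgraph isomorphic to a member of $\mathcal{F}$. For $S,T\subseteq V(G)$, not necessarily disjoint, $e_G(S,T)$ is the number of ordered pairs $(s,t)$ with $s\in S$, $t\in T$ and $st\in E(G)$. Asymptotic notation refers to $n\to\infty$ with $k$ fixed; $d\sim n^{1/k}$ means $d/n^{1/k}\to 1$, and the $o(n^{1+1/k})$ term is uniform over all $S,T$. -}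

module Defs where

open import Data.Nat as ℕ using (ℕ; zero; suc)
open import Data.Bool using (Bool; true; false)
open import Data.Fin using (Fin; zero; suc; inject₁; fromℕ)
open import Data.Fin.Subset using (Subset; inside; _∈_)
open import Data.Vec using (Vec; lookup)
open import Data.List using (List; sum; map)
open import Data.Fin.Base using ()
open import Data.Product using (Σ; _×_; _,_)
open import Data.Empty using (⊥)
open import Data.Integer using (+_)
open import Data.Rational as ℚ using (ℚ; 0ℚ; 1ℚ; _+_; _*_; _-_; _/_; _≤_; _<_; ∣_∣)
open import Relation.Binary.PropositionalEquality using (_≡_)
open import Relation.Nullary using (¬_)
open import Function.Definitions using (Injective)
import Data.Fin as F

record Graph (n : ℕ) : Set where
  field
    adj   : Fin n → Fin n → Bool
    sym   : ∀ u v → adj u v ≡ adj v u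
    irrefl : ∀ v → adj v v ≡ false
open Graph public

Σv : (n : ℕ) → (Fin n → ℕ) → ℕ
Σv zero    f = 0
Σv (suc n) f = f zero ℕ.+ Σv n (λ i → f (suc i))

b2n : Bool → ℕ
b2n true  = 1
b2n false = 0

eG : ∀ {n} → Graph n → Subset n → Subset n → ℕ
eG {n} G S T =
  Σv n (λ s → Σv n (λ t → b2n (lookup S s) ℕ.* b2n (lookup T t) ℕ.* b2n (adj G s t)))

card : ∀ {n} → Subset n → ℕ
card {n} S = Σv n (λ i → b2n (lookup S i))

ℕ→ℚ : ℕ → ℚ
ℕ→ℚ m = (+ m) / 1

-- division of a rational by a natural number (convention x / 0 = 0;
-- only used with n → ∞)
_/ℕ_ : ℚ → ℕ → ℚ
x /ℕ zero  = 0ℚ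
x /ℕ suc m = x * ((+ 1) / suc m)

_^ℚ_ : ℚ → ℕ → ℚ
x ^ℚ zero  = 1ℚ
x ^ℚ suc m = x * (x ^ℚ m)

-- average degree d = 2|E(G)|/n = e_G(V,V)/n
avgDeg : ∀ {n} → Graph n → ℚ
avgDeg {n} G = ℕ→ℚ (eG G (λ' n) (λ' n)) /ℕ n
  where
  λ' : (m : ℕ) → Subset m
  λ' m = Data.Vec.replicate m true

-- G contains a cycle of length ℓ (ℓ ≥ 3) as a subgraph:
-- injective f : Fin ℓ → V with f(i) ~ f(i+1) and f(ℓ-1) ~ f(0).
HasCycle : ∀ {n} → Graph n → ℕ → Set
HasCycle G zero = ⊥
HasCycle {n} G (suc m) =
  Σ (Fin (suc m) → Fin n) λ f →
    Injective _≡_ _≡_ f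
    × (∀ (i : Fin m) → adj G (f (inject₁ i)) (f (suc i)) ≡ true)
    × adj G (f (fromℕ m)) (f zero) ≡ true

CycleFree : ∀ {n} → ℕ → Graph n → Set
CycleFree {n} k G =
  (∀ ℓ → 3 ℕ.≤ ℓ → ℓ ℕ.≤ k → ¬ HasCycle G ℓ)
  × (∀ j → 2 ℕ.≤ j → j ℕ.≤ k → ¬ HasCycle G (2 ℕ.* j))

{-# OPTIONS --safe #-}

-- Let A be the adjacency matrix.  By the cycle conditions, two vertices are joined by at most one
-- non-backtracking walk of length k, so once the maximum degree is O(d), A^k is a 0/1 matrix P up to row
-- sums O(d^(k-1)) = o(n).  On the other hand the number of walks forces |A^k 1|² ≥ n d^(2k) ≈ n³, whence P has
-- n² - o(n²) ones, i.e. P is close to J.  So A^k is small on vectors z orthogonal to 1, and log-convexity of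
-- j ↦ |A^j z|² passes this to |A z|² = o(n d²); the same inequality for z = 1 gives |A 1 - d 1|² = o(n d²).
-- Splitting the indicator of T into its mean and its part orthogonal to 1 then gives the estimate.
--
-- The maximum degree is bounded by deleting the edges at the set H of vertices of degree at least K d.  They are
-- few: were there more than p |H| + q n of them, discarding vertices of low degree would leave a pair of vertex
-- sets between which non-backtracking walks of length k branch at least p-fold and q-fold alternately, and
-- so reach p q p q ⋯ > n distinct vertices.

module Submission where

open import Defs
open import Data.Nat as ℕ using (ℕ; zero; suc; z≤n; s≤s)
open import Data.Fin.Subset using (Subset)
open import Data.Product using (Σ; ∃; _×_; _,_; proj₁; proj₂)
open import Data.Rational as ℚ using (ℚ; 0ℚ; 1ℚ; ½; _+_; _*_; _-_; -_; _≤_; _<_; ∣_∣)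
import Data.Nat.Properties as ℕ
import Data.Rational.Properties as ℚ
import Data.Integer as ℤ
import Data.Integer.Properties as ℤ
open import Data.Nat.Coprimality using (1-coprimeTo) renaming (sym to coprime-sym)
open import Data.Bool using (Bool; true; false; _∧_; not)
import Data.Bool.Properties as Bool
open import Data.Fin using (Fin; zero; suc; toℕ; inject₁; fromℕ)
import Data.Fin.Properties as Fin
open import Data.Vec using (lookup; replicate)
open import Data.Vec.Properties using (lookup-replicate)
open import Data.Sum using (inj₁; inj₂)
open import Data.Empty using (⊥)
open import Function using (_∘_)
open import Level using (0ℓ)
open import Relation.Nullary using (Dec; yes; no; contradiction)
open import Relation.Nullary.Decidable using (⌊_⌋; _×-dec_; dec⇒maybe)
open import Relation.Binary.Definitions using (tri<; tri≈; tri>)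
open import Relation.Binary.PropositionalEquality
  using (_≡_; _≢_; refl; trans; cong; cong₂; subst; subst₂; module ≡-Reasoning) renaming (sym to ≡-sym)
open import Algebra.Bundles using (CommutativeRing)
open CommutativeRing ℚ.+-*-commutativeRing using (semiring; commutativeSemiring)
open import Algebra.Properties.Semiring.Sum semiring
  using (sum; sum-cong-≗; ∑-distrib-+; ∑-comm; *-distribˡ-sum; *-distribʳ-sum)
import Algebra.Properties.Semiring.Exp semiring as Exp
import Algebra.Properties.CommutativeSemiring.Exp commutativeSemiring as CExp
import Algebra.Properties.Semiring.Sum ℕ.+-*-semiring as ℕΣ
open import Tactic.RingSolver.Core.AlmostCommutativeRing using (AlmostCommutativeRing; fromCommutativeRing)
open import Tactic.RingSolver using (solve-∀)
import Data.Nat.Tactic.RingSolver as ℕ-Solver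

-- The cycle conditions say nothing about single degrees, and one huge degree would make the
-- backtracking walks, the error in `A^k ≈ P`, uncontrollable. The truncation may cost only a small
-- multiple of `n d`, which dictates its parameters: `q` is about `θ d` and `p = K q`. At most
-- `n / K` vertices have degree `K d` or more, so `p |H|` and `q n` are both at most `θ n d`. As
-- `q^k` is about `θ^k n`, and `K` is chosen after `θ`, a single factor `K` lifts the alternating
-- product above `n`. That `P` has nearly `n²` ones follows from a lower bound on `|P 1|²` because
-- its row sums are at most `n`: `|P 1|²` is then at most `n` times the number of ones. All
-- arithmetic is in the rationals, so neither `n^(1/k)` nor an eigenvalue ever appears. Sizes are
-- compared through `k`-th powers, and roots are taken by cancelling powers. The constants are fixed
-- in the order `ε`, `e`, `κ`, `Ω`, `θ`, `K`, and the least admissible `n` comes last.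

private variable n : ℕ

-- Non-backtracking walks

-- The walk is a total sequence of which only the values at `0`, ..., `L` matter, so that shifting,
-- shortening, reversing and gluing are mere reindexings.
record NBWalk (G : Graph n) (L : ℕ) (x : ℕ → Fin n) : Set where
  field
    adjacent : ∀ t → t ℕ.< L → adj G (x t) (x (suc t)) ≡ true
    nonback  : ∀ t → suc t ℕ.< L → x t ≢ x (suc (suc t))
open NBWalk

shift : ∀ {G : Graph n} {L x} a → NBWalk G (L ℕ.+ a) x → NBWalk G L (λ t → x (t ℕ.+ a))
shift a w .adjacent t t<L = adjacent w (t ℕ.+ a) (ℕ.+-monoˡ-< a t<L)
shift a w .nonback  t t<L = nonback w (t ℕ.+ a) (ℕ.+-monoˡ-< a t<L)

shorten : ∀ {G : Graph n} {L M x} → M ℕ.≤ L → NBWalk G L x → NBWalk G M x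
shorten M≤L w .adjacent t t<M = adjacent w t (ℕ.<-≤-trans t<M M≤L)
shorten M≤L w .nonback  t t<M = nonback w t (ℕ.<-≤-trans t<M M≤L)

reverse : ∀ {G : Graph n} {L x} → NBWalk G L x → NBWalk G L (λ t → x (L ℕ.∸ t))
reverse {G = G} {L} {x} w .adjacent t t<L = begin
  adj G (x (L ℕ.∸ t)) (x (L ℕ.∸ suc t))        ≡⟨ sym G _ _ ⟩
  adj G (x (L ℕ.∸ suc t)) (x (L ℕ.∸ t))        ≡⟨ cong (adj G (x (L ℕ.∸ suc t)) ∘ x) (ℕ.+-∸-assoc 1 t<L) ⟩
  adj G (x (L ℕ.∸ suc t)) (x (suc (L ℕ.∸ suc t))) ≡⟨ adjacent w _ (subst (ℕ._≤ L) (ℕ.+-∸-assoc 1 t<L) (ℕ.m∸n≤m L t)) ⟩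
  true ∎
  where open ≡-Reasoning
reverse {G = G} {L} {x} w .nonback t t<L e =
  nonback w (L ℕ.∸ suc (suc t)) (subst (ℕ._≤ L) two (ℕ.m∸n≤m L t)) (trans (≡-sym e) (cong x two))
  where
  two : L ℕ.∸ t ≡ suc (suc (L ℕ.∸ suc (suc t)))
  two = trans (ℕ.+-∸-assoc 1 (ℕ.<⇒≤ t<L)) (cong suc (ℕ.+-∸-assoc 1 t<L))

closed⇒cycle : ∀ (G : Graph n) m x → NBWalk G (suc m) x → x (suc m) ≡ x 0 →
  (∀ s t → s ℕ.< t → t ℕ.< suc m → x s ≢ x t) → HasCycle G (suc m)
closed⇒cycle G m x w closed distinct = (x ∘ toℕ) , inj , edge , last
  where
  inj : ∀ {i j} → x (toℕ i) ≡ x (toℕ j) → i ≡ j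
  inj {i} {j} e with ℕ.<-cmp (toℕ i) (toℕ j)
  ... | tri< i<j _ _ = contradiction e (distinct _ _ i<j (Fin.toℕ<n j))
  ... | tri≈ _ i≡j _ = Fin.toℕ-injective i≡j
  ... | tri> _ _ j<i = contradiction (≡-sym e) (distinct _ _ j<i (Fin.toℕ<n i))
  edge : ∀ i → adj G (x (toℕ (inject₁ i))) (x (suc (toℕ i))) ≡ true
  edge i rewrite Fin.toℕ-inject₁ i = adjacent w _ (ℕ.m<n⇒m<1+n (Fin.toℕ<n i))
  last : adj G (x (toℕ (fromℕ m))) (x 0) ≡ true
  last rewrite Fin.toℕ-fromℕ m | ≡-sym closed = adjacent w m ℕ.≤-refl

-- Meant for p 0 ≡ q 0: p backwards from p i, then q.
glue : ℕ → (ℕ → Fin n) → (ℕ → Fin n) → ℕ → Fin n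
glue zero    p q t       = q t
glue (suc i) p q zero    = p (suc i)
glue (suc i) p q (suc t) = glue i p q t

glue-+ : ∀ i (p q : ℕ → Fin n) t → glue i p q (t ℕ.+ i) ≡ q t
glue-+ zero    p q t = cong q (ℕ.+-identityʳ t)
glue-+ (suc i) p q t rewrite ℕ.+-suc t i = glue-+ i p q t

glue-∸ : ∀ i (p q : ℕ → Fin n) → p 0 ≡ q 0 → ∀ t → t ℕ.≤ i → glue i p q t ≡ p (i ℕ.∸ t)
glue-∸ zero    p q e zero    _         = ≡-sym e
glue-∸ (suc i) p q e zero    _         = refl
glue-∸ (suc i) p q e (suc t) (s≤s t≤i) = glue-∸ i p q e t t≤i

-- Backtracking could arise only at the junction, whose two neighbours are `p 1` and `q 1`.
glue-walk : ∀ {G : Graph n} {p q} i j → p 0 ≡ q 0 → p 1 ≢ q 1 →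
  NBWalk G i p → NBWalk G j q → NBWalk G (i ℕ.+ j) (glue i p q)
glue-walk zero j e ne wp wq = wq
glue-walk {G = G} {p} {q} (suc i) j e ne wp wq = record { adjacent = adj′ ; nonback = nb′ }
  where
  rest : NBWalk G (i ℕ.+ j) (glue i p q)
  rest = glue-walk i j e ne (shorten (ℕ.n≤1+n i) wp) wq
  adj′ : ∀ t → t ℕ.< suc (i ℕ.+ j) → adj G (glue (suc i) p q t) (glue i p q t) ≡ true
  adj′ zero    _         rewrite glue-∸ i p q e 0 z≤n = trans (sym G _ _) (adjacent wp i ℕ.≤-refl)
  adj′ (suc t) (s≤s t<L) = adjacent rest t t<L
  nb-head : ∀ i → NBWalk G (suc i) p → p (suc i) ≢ glue i p q 1
  nb-head zero    wp = ne
  nb-head (suc i) wp eq = nonback wp i ℕ.≤-refl (≡-sym (trans eq (glue-∸ i p q e 0 z≤n)))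
  nb′ : ∀ t → suc t ℕ.< suc (i ℕ.+ j) → glue (suc i) p q t ≢ glue i p q (suc t)
  nb′ zero    _         = nb-head i wp
  nb′ (suc t) (s≤s t<L) = nonback rest t t<L

module _ {k : ℕ} {G : Graph n} (free : CycleFree k G) where

  -- Strong induction with `bound` as fuel. A repeated vertex cuts out a shorter closed walk of the
  -- same kind, since nothing is required where a walk closes. Without repetition, length 1 is a
  -- loop, length 2 a backtrack, and any greater length a forbidden cycle.
  no-short-return : ∀ bound ℓ x → ℓ ℕ.< bound → suc ℓ ℕ.≤ k → NBWalk G (suc ℓ) x → x (suc ℓ) ≢ x 0
  no-short-return (suc bound) ℓ x (s≤s ℓ≤bound) ℓ<k w closed = go ℓ refl
    where
    distinct : ∀ s t → s ℕ.< t → t ℕ.< suc ℓ → x s ≢ x t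
    distinct s t s<t t<ℓ e with ℕ.m≤n⇒∃[o]m+o≡n s<t
    ... | o , refl = no-short-return bound o (λ r → x (r ℕ.+ s)) (ℕ.<-≤-trans o<ℓ ℓ≤bound)
                       (ℕ.≤-trans o<ℓ (ℕ.<⇒≤ ℓ<k)) (shift s (shorten le w))
                       (trans (cong (x ∘ suc) (ℕ.+-comm o s)) (≡-sym e))
      where
      o<ℓ : o ℕ.< ℓ
      o<ℓ = ℕ.≤-trans (s≤s (ℕ.m≤n+m o s)) (ℕ.s≤s⁻¹ t<ℓ)
      le : suc o ℕ.+ s ℕ.≤ suc ℓ
      le rewrite ℕ.+-comm o s = ℕ.<⇒≤ t<ℓ
    go : ∀ ℓ′ → ℓ′ ≡ ℓ → ⊥
    go 0 refl with trans (≡-sym (irrefl G (x 0))) (subst (λ v → adj G (x 0) v ≡ true) closed (adjacent w 0 ℕ.≤-refl))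
    ... | ()
    go 1 refl = nonback w 0 ℕ.≤-refl (≡-sym closed)
    go (suc (suc ℓ′)) refl =
      proj₁ free _ (s≤s (s≤s (s≤s z≤n))) ℓ<k (closed⇒cycle G ℓ x w closed distinct)

  -- Running backwards along `p` and on along `q`, a meeting would close up a walk of length
  -- `i + j`. The two lengths are independent, as the arcs in `no-first-meeting` require.
  no-short-meeting : ∀ {p q} i j → p 0 ≡ q 0 → p 1 ≢ q 1 → NBWalk G i p → NBWalk G j q →
    0 ℕ.< i ℕ.+ j → i ℕ.+ j ℕ.≤ k → p i ≢ q j
  no-short-meeting {p} {q} i j e ne wp wq 0<L L≤k meet with i ℕ.+ j in eq
  ... | suc L = no-short-return (suc L) L (glue i p q) ℕ.≤-refl L≤k
        (subst (λ m → NBWalk G m (glue i p q)) eq (glue-walk i j e ne wp wq)) (begin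
          glue i p q (suc L)     ≡⟨ cong (glue i p q) (trans (≡-sym eq) (ℕ.+-comm i j)) ⟩
          glue i p q (j ℕ.+ i)   ≡⟨ glue-+ i p q j ⟩
          q j                    ≡⟨ meet ⟨
          p i                    ≡⟨ glue-∸ i p q e 0 z≤n ⟨
          glue i p q 0           ∎)
    where open ≡-Reasoning

  -- Two walks meeting only after m steps close up to a walk of length 2m.  A repeated vertex would cut it
  -- into two closed arcs, the shorter of length at most m ≤ k; hence it is an even cycle.
  no-first-meeting : ∀ {p q} m → 2 ℕ.≤ m → m ℕ.≤ k → NBWalk G m p → NBWalk G m q →
    p 0 ≡ q 0 → p 1 ≢ q 1 → p (m ℕ.∸ 1) ≢ q (m ℕ.∸ 1) → p m ≢ q m
  no-first-meeting {p} {q} m@(suc m′) 2≤m m≤k wp wq e₀ ne₁ ne′ e =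
    proj₂ free m 2≤m m≤k (subst (HasCycle G) length≡ (closed⇒cycle G (m′ ℕ.+ m) x wx closed distinct))
    where
    x = glue m p q
    wx : NBWalk G (m ℕ.+ m) x
    wx = glue-walk m m e₀ ne₁ wp wq
    length≡ : m ℕ.+ m ≡ 2 ℕ.* m
    length≡ = cong (m ℕ.+_) (≡-sym (ℕ.+-identityʳ m))
    closed : x (m ℕ.+ m) ≡ x 0
    closed = trans (glue-+ m p q m) (≡-sym e)
    distinct : ∀ s t → s ℕ.< t → t ℕ.< m ℕ.+ m → x s ≢ x t
    distinct s t s<t t<2m eq with t ℕ.≤? s ℕ.+ k
    ... | yes t≤s+k with ℕ.m≤n⇒∃[o]m+o≡n s<t
    ...   | o , refl = no-short-return (suc o) o (λ r → x (r ℕ.+ s)) ℕ.≤-refl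
                         (ℕ.+-cancelˡ-≤ s _ _ (subst (ℕ._≤ s ℕ.+ k) (≡-sym (ℕ.+-suc s o)) t≤s+k))
                         (shift s (shorten le wx))
                         (trans (cong (x ∘ suc) (ℕ.+-comm o s)) (≡-sym eq))
      where
      le : suc o ℕ.+ s ℕ.≤ m ℕ.+ m
      le rewrite ℕ.+-comm o s = ℕ.<⇒≤ t<2m
    distinct s t s<t t<2m eq | no t≰s+k =
      -- The arc that avoids the direct way from `x s` to `x t` passes the common end `p m ≡ q m`.
      -- Seen from there it is `s` steps back along `p` and `j` steps back along `q`, and `ne′`
      -- excludes backtracking at that end.
      no-short-meeting {λ r → p (m ℕ.∸ r)} {λ r → q (m ℕ.∸ r)} s j e ne′
        (shorten (ℕ.<⇒≤ s<m) (reverse wp)) (shorten (ℕ.m∸n≤m m i) (reverse wq)) pos le meet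
      where
      s+m<t : s ℕ.+ m ℕ.< t
      s+m<t = ℕ.≤-<-trans (ℕ.+-monoʳ-≤ s m≤k) (ℕ.≰⇒> t≰s+k)
      s<m : s ℕ.< m
      s<m = ℕ.+-cancelʳ-< m s m (ℕ.<-trans s+m<t t<2m)
      i = t ℕ.∸ m
      j = m ℕ.∸ i
      t≡ : t ≡ i ℕ.+ m
      t≡ = ≡-sym (ℕ.m∸n+n≡m (ℕ.≤-trans (ℕ.m≤n+m m s) (ℕ.<⇒≤ s+m<t)))
      i<m : i ℕ.< m
      i<m = ℕ.+-cancelʳ-< m i m (subst (ℕ._< m ℕ.+ m) t≡ t<2m)
      s<i : s ℕ.< i
      s<i = ℕ.+-cancelʳ-< m s i (subst (s ℕ.+ m ℕ.<_) t≡ s+m<t)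
      pos : 0 ℕ.< s ℕ.+ j
      pos = ℕ.<-≤-trans (ℕ.m<n⇒0<n∸m i<m) (ℕ.m≤n+m j s)
      le : s ℕ.+ j ℕ.≤ k
      le = ℕ.≤-trans (ℕ.+-monoˡ-≤ j (ℕ.<⇒≤ s<i)) (ℕ.≤-trans (ℕ.≤-reflexive (ℕ.m+[n∸m]≡n (ℕ.<⇒≤ i<m))) m≤k)
      meet : p (m ℕ.∸ s) ≡ q (m ℕ.∸ j)
      meet = begin
        p (m ℕ.∸ s) ≡⟨ glue-∸ m p q e₀ s (ℕ.<⇒≤ s<m) ⟨
        x s         ≡⟨ eq ⟩
        x t         ≡⟨ cong x t≡ ⟩
        x (i ℕ.+ m) ≡⟨ glue-+ m p q i ⟩
        q i         ≡⟨ cong q (ℕ.m∸[m∸n]≡n (ℕ.<⇒≤ i<m)) ⟨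
        q (m ℕ.∸ j) ∎
        where open ≡-Reasoning

  -- By induction the walks are still apart one step before the end, so a meeting at the end would
  -- be the one excluded by `no-first-meeting`.
  no-meeting : ∀ {p q} m → NBWalk G (suc m) p → NBWalk G (suc m) q →
    suc m ℕ.≤ k → p 0 ≡ q 0 → p 1 ≢ q 1 → p (suc m) ≢ q (suc m)
  no-meeting zero    wp wq m<k e₀ ne₁ = ne₁
  no-meeting (suc m) wp wq m<k e₀ ne₁ =
    no-first-meeting (suc (suc m)) (s≤s (s≤s z≤n)) m<k wp wq e₀ ne₁
      (no-meeting m (shorten (ℕ.n≤1+n _) wp) (shorten (ℕ.n≤1+n _) wq) (ℕ.<⇒≤ m<k) e₀ ne₁)

-- Counting walks and edges

Σv≡sum : ∀ n (f : Fin n → ℕ) → Σv n f ≡ ℕΣ.sum f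
Σv≡sum zero    f = refl
Σv≡sum (suc n) f = cong (f zero ℕ.+_) (Σv≡sum n (f ∘ suc))

Σv-cong : ∀ n {f g : Fin n → ℕ} → (∀ i → f i ≡ g i) → Σv n f ≡ Σv n g
Σv-cong zero    f≡g = refl
Σv-cong (suc n) f≡g = cong₂ ℕ._+_ (f≡g zero) (Σv-cong n (f≡g ∘ suc))

Σv-mono : ∀ n {f g : Fin n → ℕ} → (∀ i → f i ℕ.≤ g i) → Σv n f ℕ.≤ Σv n g
Σv-mono zero    f≤g = z≤n
Σv-mono (suc n) f≤g = ℕ.+-mono-≤ (f≤g zero) (Σv-mono n (f≤g ∘ suc))

Σv-+ : ∀ n (f g : Fin n → ℕ) → Σv n (λ i → f i ℕ.+ g i) ≡ Σv n f ℕ.+ Σv n g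
Σv-+ n f g = begin
  Σv n (λ i → f i ℕ.+ g i)  ≡⟨ Σv≡sum n _ ⟩
  ℕΣ.sum (λ i → f i ℕ.+ g i) ≡⟨ ℕΣ.∑-distrib-+ f g ⟩
  ℕΣ.sum f ℕ.+ ℕΣ.sum g ≡⟨ cong₂ ℕ._+_ (Σv≡sum n f) (Σv≡sum n g) ⟨
  Σv n f ℕ.+ Σv n g ∎
  where open ≡-Reasoning

Σv-*ˡ : ∀ n c (f : Fin n → ℕ) → Σv n (λ i → c ℕ.* f i) ≡ c ℕ.* Σv n f
Σv-*ˡ n c f = begin
  Σv n (λ i → c ℕ.* f i)   ≡⟨ Σv≡sum n _ ⟩
  ℕΣ.sum (λ i → c ℕ.* f i) ≡⟨ ℕΣ.*-distribˡ-sum c f ⟨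
  c ℕ.* ℕΣ.sum f           ≡⟨ cong (c ℕ.*_) (Σv≡sum n f) ⟨
  c ℕ.* Σv n f             ∎
  where open ≡-Reasoning

Σv-*ʳ : ∀ n (f : Fin n → ℕ) c → Σv n (λ i → f i ℕ.* c) ≡ Σv n f ℕ.* c
Σv-*ʳ n f c = begin
  Σv n (λ i → f i ℕ.* c)   ≡⟨ Σv≡sum n _ ⟩
  ℕΣ.sum (λ i → f i ℕ.* c) ≡⟨ ℕΣ.*-distribʳ-sum c f ⟨
  ℕΣ.sum f ℕ.* c           ≡⟨ cong (ℕ._* c) (Σv≡sum n f) ⟨
  Σv n f ℕ.* c             ∎
  where open ≡-Reasoning

Σv-swap : ∀ m n (f : Fin m → Fin n → ℕ) →
  Σv m (λ i → Σv n (f i)) ≡ Σv n (λ j → Σv m (λ i → f i j))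
Σv-swap m n f = begin
  Σv m (λ i → Σv n (f i))                ≡⟨ Σv-cong m (λ i → Σv≡sum n (f i)) ⟩
  Σv m (λ i → ℕΣ.sum (f i))              ≡⟨ Σv≡sum m _ ⟩
  ℕΣ.sum (λ i → ℕΣ.sum (f i))            ≡⟨ ℕΣ.∑-comm f ⟩
  ℕΣ.sum (λ j → ℕΣ.sum (λ i → f i j))    ≡⟨ Σv≡sum n _ ⟨
  Σv n (λ j → ℕΣ.sum (λ i → f i j))      ≡⟨ Σv-cong n (λ j → Σv≡sum m (λ i → f i j)) ⟨
  Σv n (λ j → Σv m (λ i → f i j))        ∎
  where open ≡-Reasoning

Σv-zero : ∀ n {f : Fin n → ℕ} → (∀ i → f i ≡ 0) → Σv n f ≡ 0
Σv-zero zero    f≡0 = refl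
Σv-zero (suc n) f≡0 = cong₂ ℕ._+_ (f≡0 zero) (Σv-zero n (f≡0 ∘ suc))

Σv-≤n : ∀ n {f : Fin n → ℕ} → (∀ i → f i ℕ.≤ 1) → Σv n f ℕ.≤ n
Σv-≤n zero    f≤1 = z≤n
Σv-≤n (suc n) f≤1 = ℕ.+-mono-≤ (f≤1 zero) (Σv-≤n n (f≤1 ∘ suc))

Σv-pos : ∀ n {f : Fin n → ℕ} → 0 ℕ.< Σv n f → ∃ λ i → 0 ℕ.< f i
Σv-pos (suc n) {f} pos with f zero in eq
... | suc _ = zero , subst (0 ℕ.<_) (≡-sym eq) (s≤s z≤n)
... | zero with Σv-pos n pos
...   | i , fi>0 = suc i , fi>0

Σv-point : ∀ n (a : Fin n) (f : Fin n → ℕ) → Σv n (λ x → b2n ⌊ x Fin.≟ a ⌋ ℕ.* f x) ≡ f a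
Σv-point (suc n) zero f = begin
  f zero ℕ.+ 0 ℕ.+ Σv n (λ _ → 0) ≡⟨ cong₂ ℕ._+_ (ℕ.+-identityʳ _) (Σv-zero n (λ _ → refl)) ⟩
  f zero ℕ.+ 0                    ≡⟨ ℕ.+-identityʳ _ ⟩
  f zero                          ∎
  where open ≡-Reasoning
Σv-point (suc n) (suc a) f = trans (Σv-cong n eq) (Σv-point n a (f ∘ suc))
  where
  eq : ∀ x → b2n ⌊ suc x Fin.≟ suc a ⌋ ℕ.* f (suc x) ≡ b2n ⌊ x Fin.≟ a ⌋ ℕ.* f (suc x)
  eq x with x Fin.≟ a
  ... | yes _ = refl
  ... | no  _ = refl

Σv-unique : ∀ n {f : Fin n → ℕ} → (∀ i → f i ℕ.≤ 1) →
  (∀ i j → 0 ℕ.< f i → 0 ℕ.< f j → i ≡ j) → Σv n f ℕ.≤ 1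
Σv-unique zero    f≤1 uniq = z≤n
Σv-unique (suc n) {f} f≤1 uniq with f zero in eq
... | zero  = Σv-unique n (f≤1 ∘ suc) (λ i j p q → Fin.suc-injective (uniq _ _ p q))
... | suc m = begin
  suc m ℕ.+ Σv n (f ∘ suc) ≡⟨ cong (suc m ℕ.+_) (Σv-zero n none) ⟩
  suc m ℕ.+ 0              ≡⟨ ℕ.+-identityʳ _ ⟩
  suc m                    ≡⟨ eq ⟨
  f zero                   ≤⟨ f≤1 zero ⟩
  1                        ∎
  where
  open ℕ.≤-Reasoning
  none : ∀ i → f (suc i) ≡ 0
  none i with f (suc i) in eq′
  ... | zero  = refl
  ... | suc _ with () ← uniq zero (suc i) (subst (0 ℕ.<_) (≡-sym eq) (s≤s z≤n)) (subst (0 ℕ.<_) (≡-sym eq′) (s≤s z≤n))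

b2n≤1 : ∀ b → b2n b ℕ.≤ 1
b2n≤1 true  = s≤s z≤n
b2n≤1 false = z≤n

b2n-*-≤ : ∀ b m → b2n b ℕ.* m ℕ.≤ m
b2n-*-≤ true  m = ℕ.≤-reflexive (ℕ.+-identityʳ m)
b2n-*-≤ false m = z≤n

-- Counts the non-backtracking walks of length j from v to w that arrived at v from u; taking u = v
-- puts no restriction on the first step, as there are no loops.
nb : Graph n → ℕ → Fin n → Fin n → Fin n → ℕ
nb     G zero    u v w = b2n ⌊ v Fin.≟ w ⌋
nb {n} G (suc j) u v w = Σv n λ x → b2n (adj G v x ∧ not ⌊ x Fin.≟ u ⌋) ℕ.* nb G j v x w

*-pos : ∀ a b → 0 ℕ.< a ℕ.* b → 0 ℕ.< a × 0 ℕ.< b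
*-pos (suc a) zero    pos = contradiction (subst (0 ℕ.<_) (ℕ.*-zeroʳ a) pos) λ ()
*-pos (suc a) (suc b) _   = s≤s z≤n , s≤s z≤n

step-pos : ∀ (G : Graph n) u v x → 0 ℕ.< b2n (adj G v x ∧ not ⌊ x Fin.≟ u ⌋) → adj G v x ≡ true × x ≢ u
step-pos G u v x pos with adj G v x | x Fin.≟ u
step-pos G u v x pos | true | no x≢u = refl , x≢u

nb⇒walk : ∀ (G : Graph n) j u v w → 0 ℕ.< nb G j u v w →
  ∃ λ p → NBWalk G j p × p 0 ≡ v × p j ≡ w × (0 ℕ.< j → p 1 ≢ u)
-- Keeps track of the second vertex `x`, because `nb≤1` has to know that different summands yield
-- walks parting at the first step.
step⇒walk : ∀ (G : Graph n) j u v w x → 0 ℕ.< b2n (adj G v x ∧ not ⌊ x Fin.≟ u ⌋) ℕ.* nb G j v x w →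
  ∃ λ p → NBWalk G (suc j) p × p 0 ≡ v × p 1 ≡ x × p (suc j) ≡ w × p 1 ≢ u

nb⇒walk G zero u v w pos with v Fin.≟ w
... | yes v≡w = (λ _ → v) , record { adjacent = λ _ () ; nonback = λ _ () } , refl , v≡w , λ ()
nb⇒walk {n} G (suc j) u v w pos with Σv-pos n pos
... | x , posx with step⇒walk G j u v w x posx
...   | p , wp , start , _ , end , p₁≢u = p , wp , start , end , λ _ → p₁≢u

step⇒walk {n} G j u v w x pos with *-pos (b2n (adj G v x ∧ not ⌊ x Fin.≟ u ⌋)) _ pos
... | pos₁ , pos₂ with step-pos G u v x pos₁ | nb⇒walk G j v x w pos₂
...   | vx , x≢u | p , wp , refl , end , first = p′ , walk , refl , refl , end , x≢u
  where
  p′ : ℕ → Fin n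
  p′ zero    = v
  p′ (suc t) = p t
  walk : NBWalk G (suc j) p′
  walk .adjacent zero    _         = vx
  walk .adjacent (suc t) (s≤s t<j) = adjacent wp t t<j
  walk .nonback  zero    (s≤s 0<j) = first 0<j ∘ ≡-sym
  walk .nonback  (suc t) (s≤s t<j) = nonback wp t t<j

-- Each summand over the second vertex is at most 1 by induction. Two nonzero summands would give
-- walks with the same ends that part at once, against `no-meeting`.
nb≤1 : ∀ {k} {G : Graph n} → CycleFree k G → ∀ j → j ℕ.≤ k → ∀ u v w → nb G j u v w ℕ.≤ 1
nb≤1 free zero    j≤k u v w = b2n≤1 ⌊ v Fin.≟ w ⌋
nb≤1 {n} {G = G} free (suc j) j<k u v w = Σv-unique n
  (λ x → ℕ.≤-trans (b2n-*-≤ (adj G v x ∧ not ⌊ x Fin.≟ u ⌋) _) (nb≤1 free j (ℕ.<⇒≤ j<k) v x w)) unique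
  where
  unique : ∀ x y → 0 ℕ.< b2n (adj G v x ∧ not ⌊ x Fin.≟ u ⌋) ℕ.* nb G j v x w →
                   0 ℕ.< b2n (adj G v y ∧ not ⌊ y Fin.≟ u ⌋) ℕ.* nb G j v y w → x ≡ y
  unique x y px py with step⇒walk G j u v w x px | step⇒walk G j u v w y py
  ... | p , wp , p₀ , p₁ , pw , _ | q , wq , q₀ , q₁ , qw , _ with x Fin.≟ y
  ...   | yes x≡y = x≡y
  ...   | no  x≢y = contradiction (trans pw (≡-sym qw))
                      (no-meeting free j wp wq j<k (trans p₀ (≡-sym q₀))
                        λ e → x≢y (trans (≡-sym p₁) (trans e q₁)))

reach : ∀ (G : Graph n) → ℕ → Fin n → Fin n → ℕ
reach {n} G j u v = Σv n (nb G j u v)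

alternating : ℕ → ℕ → ℕ → ℕ
alternating p q zero    = 1
alternating p q (suc j) = p ℕ.* alternating q p j

degIn : Graph n → (Fin n → Bool) → Fin n → ℕ
degIn {n} G B v = Σv n λ x → b2n (B x) ℕ.* b2n (adj G v x)

-- The degree conditions are strict because one neighbour may be lost to the ban on returning to
-- `u`. At least `p` neighbours remain, and from them the walk continues with the roles of `A` and
-- `B` exchanged.
alternating≤reach : ∀ (G : Graph n) {A B : Fin n → Bool} {p q} →
  (∀ v → A v ≡ true → p ℕ.< degIn G B v) → (∀ v → B v ≡ true → q ℕ.< degIn G A v) →
  ∀ j u v → A v ≡ true → alternating p q j ℕ.≤ reach G j u v
alternating≤reach {n} G degA degB zero u v _ = ℕ.≤-reflexive (≡-sym (begin
  Σv n (λ w → b2n ⌊ v Fin.≟ w ⌋)          ≡⟨ Σv-cong n (λ w → trans (flip w) (≡-sym (ℕ.*-identityʳ _))) ⟩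
  Σv n (λ w → b2n ⌊ w Fin.≟ v ⌋ ℕ.* 1)    ≡⟨ Σv-point n v (λ _ → 1) ⟩
  1 ∎))
  where
  open ≡-Reasoning
  flip : ∀ w → b2n ⌊ v Fin.≟ w ⌋ ≡ b2n ⌊ w Fin.≟ v ⌋
  flip w with v Fin.≟ w | w Fin.≟ v
  ... | yes _ | yes _ = refl
  ... | no  _ | no  _ = refl
  ... | yes e | no ne = contradiction (≡-sym e) ne
  ... | no ne | yes e = contradiction (≡-sym e) ne
alternating≤reach {n} G {A} {B} {p} {q} degA degB (suc j) u v Av = begin
  p ℕ.* alternating q p j
    ≤⟨ ℕ.*-monoˡ-≤ _ p≤ ⟩
  Σv n (λ x → b2n (B x) ℕ.* c x) ℕ.* alternating q p j
    ≡⟨ Σv-*ʳ n _ _ ⟨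
  Σv n (λ x → b2n (B x) ℕ.* c x ℕ.* alternating q p j)
    ≤⟨ Σv-mono n term ⟩
  Σv n (λ x → c x ℕ.* reach G j v x)
    ≡⟨ Σv-cong n (λ x → Σv-*ˡ n (c x) _) ⟨
  Σv n (λ x → Σv n (λ w → c x ℕ.* nb G j v x w))
    ≡⟨ Σv-swap n n _ ⟩
  reach G (suc j) u v ∎
  where
  open ℕ.≤-Reasoning
  c : Fin n → ℕ
  c x = b2n (adj G v x ∧ not ⌊ x Fin.≟ u ⌋)
  term : ∀ x → b2n (B x) ℕ.* c x ℕ.* alternating q p j ℕ.≤ c x ℕ.* reach G j v x
  term x with B x in eq
  ... | true rewrite ℕ.+-identityʳ (c x) = ℕ.*-monoʳ-≤ (c x) (alternating≤reach G degB degA j v x eq)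
  ... | false = z≤n
  pointwise : ∀ x → b2n (B x) ℕ.* b2n (adj G v x) ℕ.≤ b2n ⌊ x Fin.≟ u ⌋ ℕ.* 1 ℕ.+ b2n (B x) ℕ.* c x
  pointwise x with B x | adj G v x | x Fin.≟ u
  ... | false | _     | _     = z≤n
  ... | true  | false | _     = z≤n
  ... | true  | true  | yes _ = s≤s z≤n
  ... | true  | true  | no  _ = s≤s z≤n
  p≤ : p ℕ.≤ Σv n (λ x → b2n (B x) ℕ.* c x)
  p≤ = ℕ.s≤s⁻¹ (begin
    suc p ≤⟨ degA v Av ⟩
    degIn G B v ≤⟨ Σv-mono n pointwise ⟩
    Σv n (λ x → b2n ⌊ x Fin.≟ u ⌋ ℕ.* 1 ℕ.+ b2n (B x) ℕ.* c x) ≡⟨ Σv-+ n _ _ ⟩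
    Σv n (λ x → b2n ⌊ x Fin.≟ u ⌋ ℕ.* 1) ℕ.+ Σv n (λ x → b2n (B x) ℕ.* c x) ≡⟨ cong (ℕ._+ Σv n (λ x → b2n (B x) ℕ.* c x)) (Σv-point n u (λ _ → 1)) ⟩
    suc (Σv n (λ x → b2n (B x) ℕ.* c x)) ∎)

-- Edges between two vertex sets

size : (Fin n → Bool) → ℕ
size {n} A = Σv n (b2n ∘ A)

edges : Graph n → (Fin n → Bool) → (Fin n → Bool) → ℕ
edges {n} G A B = Σv n λ a → b2n (A a) ℕ.* degIn G B a

edges-sym : ∀ (G : Graph n) A B → edges G A B ≡ edges G B A
edges-sym {n} G A B = begin
  edges G A B
    ≡⟨ Σv-cong n (λ a → Σv-*ˡ n (b2n (A a)) _) ⟨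
  Σv n (λ a → Σv n (λ b → b2n (A a) ℕ.* (b2n (B b) ℕ.* b2n (adj G a b))))
    ≡⟨ Σv-swap n n _ ⟩
  Σv n (λ b → Σv n (λ a → b2n (A a) ℕ.* (b2n (B b) ℕ.* b2n (adj G a b))))
    ≡⟨ Σv-cong n (λ b → Σv-cong n λ a → exchange b a) ⟩
  Σv n (λ b → Σv n (λ a → b2n (B b) ℕ.* (b2n (A a) ℕ.* b2n (adj G b a))))
    ≡⟨ Σv-cong n (λ b → Σv-*ˡ n (b2n (B b)) _) ⟩
  edges G B A ∎
  where
  open ≡-Reasoning
  comm : ∀ x y z → x ℕ.* (y ℕ.* z) ≡ y ℕ.* (x ℕ.* z)
  comm = ℕ-Solver.solve-∀
  exchange : ∀ b a → b2n (A a) ℕ.* (b2n (B b) ℕ.* b2n (adj G a b)) ≡ b2n (B b) ℕ.* (b2n (A a) ℕ.* b2n (adj G b a))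
  exchange b a rewrite sym G a b = comm (b2n (A a)) (b2n (B b)) (b2n (adj G b a))

remove : (Fin n → Bool) → Fin n → Fin n → Bool
remove A a x = A x ∧ not ⌊ x Fin.≟ a ⌋

Σv-remove : ∀ (A : Fin n → Bool) a (f : Fin n → ℕ) → A a ≡ true →
  Σv n (λ x → b2n (A x) ℕ.* f x) ≡ f a ℕ.+ Σv n (λ x → b2n (remove A a x) ℕ.* f x)
Σv-remove {n} A a f Aa = begin
  Σv n (λ x → b2n (A x) ℕ.* f x)
    ≡⟨ Σv-cong n pointwise ⟩
  Σv n (λ x → b2n ⌊ x Fin.≟ a ⌋ ℕ.* f x ℕ.+ b2n (remove A a x) ℕ.* f x)
    ≡⟨ Σv-+ n _ _ ⟩
  Σv n (λ x → b2n ⌊ x Fin.≟ a ⌋ ℕ.* f x) ℕ.+ Σv n (λ x → b2n (remove A a x) ℕ.* f x)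
    ≡⟨ cong (ℕ._+ Σv n (λ x → b2n (remove A a x) ℕ.* f x)) (Σv-point n a f) ⟩
  f a ℕ.+ Σv n (λ x → b2n (remove A a x) ℕ.* f x) ∎
  where
  open ≡-Reasoning
  pointwise : ∀ x → b2n (A x) ℕ.* f x ≡ b2n ⌊ x Fin.≟ a ⌋ ℕ.* f x ℕ.+ b2n (remove A a x) ℕ.* f x
  pointwise x with x Fin.≟ a
  ... | yes refl rewrite Aa = ≡-sym (ℕ.+-identityʳ _)
  ... | no  _    rewrite Bool.∧-identityʳ (A x) = refl

size-remove : ∀ (A : Fin n → Bool) a → A a ≡ true → size A ≡ suc (size (remove A a))
size-remove {n} A a Aa = begin
  size A                                          ≡⟨ Σv-cong n (λ x → ℕ.*-identityʳ _) ⟨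
  Σv n (λ x → b2n (A x) ℕ.* 1)                    ≡⟨ Σv-remove A a (λ _ → 1) Aa ⟩
  suc (Σv n (λ x → b2n (remove A a x) ℕ.* 1))     ≡⟨ cong suc (Σv-cong n (λ x → ℕ.*-identityʳ _)) ⟩
  suc (size (remove A a))                         ∎
  where open ≡-Reasoning

low? : ∀ (G : Graph n) (A B : Fin n → Bool) p → Dec (∃ λ a → A a ≡ true × degIn G B a ℕ.≤ p)
low? G A B p = Fin.any? λ a → (A a Bool.≟ true) ×-dec (degIn G B a ℕ.≤? p)

-- The edges lost with `a` number at most `p`, which is exactly the drop of `p * size A`.
drop-low : ∀ (G : Graph n) (A B : Fin n → Bool) {p q} a → A a ≡ true → degIn G B a ℕ.≤ p →
  edges G (remove A a) B ℕ.≤ p ℕ.* size (remove A a) ℕ.+ q ℕ.* size B →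
  edges G A B ℕ.≤ p ℕ.* size A ℕ.+ q ℕ.* size B
drop-low {n} G A B {p} {q} a Aa da≤p rest = begin
  edges G A B                                                       ≡⟨ Σv-remove A a (degIn G B) Aa ⟩
  degIn G B a ℕ.+ edges G (remove A a) B                            ≤⟨ ℕ.+-mono-≤ da≤p rest ⟩
  p ℕ.+ (p ℕ.* size (remove A a) ℕ.+ q ℕ.* size B)                  ≡⟨ ℕ.+-assoc p _ _ ⟨
  p ℕ.+ p ℕ.* size (remove A a) ℕ.+ q ℕ.* size B                    ≡⟨ cong (ℕ._+ q ℕ.* size B) (ℕ.*-suc p _) ⟨
  p ℕ.* suc (size (remove A a)) ℕ.+ q ℕ.* size B                    ≡⟨ cong (λ s → p ℕ.* s ℕ.+ q ℕ.* size B) (size-remove A a Aa) ⟨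
  p ℕ.* size A ℕ.+ q ℕ.* size B                                     ∎
  where open ℕ.≤-Reasoning

-- Discarding vertices of low degree leaves either nothing or a pair of sets in which
-- non-backtracking walks of length k reach too many vertices.
edges-bound : ∀ {k} {G : Graph n} → CycleFree k G → ∀ {p q} → n ℕ.< alternating p q k →
  ∀ A B → edges G A B ℕ.≤ p ℕ.* size A ℕ.+ q ℕ.* size B
edges-bound {n} {k} {G} free {p} {q} n<alt A B = prune (size A ℕ.+ size B) A B ℕ.≤-refl
  where
  open ℕ.≤-Reasoning
  prune : ∀ fuel (A B : Fin n → Bool) → size A ℕ.+ size B ℕ.≤ fuel → edges G A B ℕ.≤ p ℕ.* size A ℕ.+ q ℕ.* size B
  prune fuel A B le with low? G A B p | low? G B A q | Fin.any? (λ a → A a Bool.≟ true)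
  prune zero A B le | yes (a , Aa , _) | _ | _ with () ← subst (λ s → s ℕ.+ size B ℕ.≤ 0) (size-remove A a Aa) le
  prune (suc fuel) A B le | yes (a , Aa , da≤p) | _ | _ =
    drop-low G A B {q = q} a Aa da≤p (prune fuel (remove A a) B (ℕ.s≤s⁻¹ (subst (λ s → s ℕ.+ size B ℕ.≤ suc fuel) (size-remove A a Aa) le)))
  prune zero A B le | no _ | yes (b , Bb , _) | _
    with () ← subst (ℕ._≤ 0) (trans (cong (size A ℕ.+_) (size-remove B b Bb)) (ℕ.+-suc _ _)) le
  prune (suc fuel) A B le | no _ | yes (b , Bb , db≤q) | _ = begin
    edges G A B                        ≡⟨ edges-sym G A B ⟩
    edges G B A                        ≤⟨ drop-low G B A {q = p} b Bb db≤q (begin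
      edges G (remove B b) A                          ≡⟨ edges-sym G (remove B b) A ⟩
      edges G A (remove B b)                          ≤⟨ prune fuel A (remove B b) (ℕ.s≤s⁻¹ (subst (ℕ._≤ suc fuel)
                                                          (trans (cong (size A ℕ.+_) (size-remove B b Bb)) (ℕ.+-suc _ _)) le)) ⟩
      p ℕ.* size A ℕ.+ q ℕ.* size (remove B b)        ≡⟨ ℕ.+-comm (p ℕ.* size A) _ ⟩
      q ℕ.* size (remove B b) ℕ.+ p ℕ.* size A        ∎) ⟩
    q ℕ.* size B ℕ.+ p ℕ.* size A      ≡⟨ ℕ.+-comm (q ℕ.* size B) _ ⟩
    p ℕ.* size A ℕ.+ q ℕ.* size B      ∎
  prune fuel A B le | no highA | no highB | yes (a , Aa) = contradiction (begin
    alternating p q k      ≤⟨ alternating≤reach G {A} {B} (λ v Av → ℕ.≰⇒> λ d → highA (v , Av , d)) (λ v Bv → ℕ.≰⇒> λ d → highB (v , Bv , d)) k a a Aa ⟩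
    reach G k a a          ≤⟨ Σv-≤n n (nb≤1 free k ℕ.≤-refl a a) ⟩
    n                      ∎) (ℕ.<⇒≱ n<alt)
  prune fuel A B le | no _ | no _ | no empty = ℕ.≤-trans (ℕ.≤-reflexive (Σv-zero n none)) z≤n
    where
    none : ∀ a → b2n (A a) ℕ.* degIn G B a ≡ 0
    none a with A a in eq
    ... | true  = contradiction (a , eq) empty
    ... | false = refl

-- Rational arithmetic

ring : AlmostCommutativeRing 0ℓ 0ℓ
ring = fromCommutativeRing ℚ.+-*-commutativeRing λ x → dec⇒maybe (0ℚ ℚ.≟ x)

2ℚ 3ℚ : ℚ
2ℚ = 1ℚ + 1ℚ
3ℚ = 1ℚ + 2ℚ


0≤1 : 0ℚ ≤ 1ℚ
0≤1 = ℚ.nonNegative⁻¹ 1ℚ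

0<1 : 0ℚ < 1ℚ
0<1 = ℚ.positive⁻¹ 1ℚ

0≤+ : ∀ {a b} → 0ℚ ≤ a → 0ℚ ≤ b → 0ℚ ≤ a + b
0≤+ = ℚ.+-mono-≤

*-monoˡ : ∀ {c a b} → 0ℚ ≤ c → a ≤ b → c * a ≤ c * b
*-monoˡ {c} 0≤c = ℚ.*-monoˡ-≤-nonNeg c {{ℚ.nonNegative 0≤c}}

*-monoʳ : ∀ {c a b} → 0ℚ ≤ c → a ≤ b → a * c ≤ b * c
*-monoʳ {c} 0≤c = ℚ.*-monoʳ-≤-nonNeg c {{ℚ.nonNegative 0≤c}}

0≤* : ∀ {a b} → 0ℚ ≤ a → 0ℚ ≤ b → 0ℚ ≤ a * b
0≤* {a} {b} 0≤a 0≤b = subst (_≤ a * b) (ℚ.*-zeroʳ a) (*-monoˡ 0≤a 0≤b)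

0<* : ∀ {a b} → 0ℚ < a → 0ℚ < b → 0ℚ < a * b
0<* {a} {b} 0<a 0<b = ℚ.positive⁻¹ _ {{ℚ.pos*pos⇒pos a {{ℚ.positive 0<a}} b {{ℚ.positive 0<b}}}}

*-mono-≤ : ∀ {a c b d} → 0ℚ ≤ a → 0ℚ ≤ c → a ≤ b → c ≤ d → a * c ≤ b * d
*-mono-≤ 0≤a 0≤c a≤b c≤d = ℚ.≤-trans (*-monoʳ 0≤c a≤b) (*-monoˡ (ℚ.≤-trans 0≤a a≤b) c≤d)

*-cancelʳ : ∀ {c a b} → 0ℚ < c → a * c ≤ b * c → a ≤ b
*-cancelʳ {c} 0<c = ℚ.*-cancelʳ-≤-pos c {{ℚ.positive 0<c}}

0≤-⇒≤ : ∀ {a b} → 0ℚ ≤ b - a → a ≤ b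
0≤-⇒≤ {a} {b} 0≤b-a = subst₂ _≤_ (ℚ.+-identityˡ a) (cancel b a) (ℚ.+-monoˡ-≤ a 0≤b-a)
  where
  cancel : ∀ b a → b - a + a ≡ b
  cancel = solve-∀ ring

≤⇒0≤- : ∀ {a b} → a ≤ b → 0ℚ ≤ b - a
≤⇒0≤- {a} {b} a≤b = subst (_≤ b - a) (ℚ.+-inverseʳ a) (ℚ.+-monoˡ-≤ (- a) a≤b)

≤-from-slack : ∀ {a b r} → 0ℚ ≤ r → b - a ≡ r → a ≤ b
≤-from-slack 0≤r eq = 0≤-⇒≤ (subst (0ℚ ≤_) (≡-sym eq) 0≤r)

∣∣≤ : ∀ {a b} → a ≤ b → - a ≤ b → ∣ a ∣ ≤ b
∣∣≤ {a} a≤b -a≤b with ℚ.∣p∣≡p∨∣p∣≡-p a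
... | inj₁ eq = subst (_≤ _) (≡-sym eq) a≤b
... | inj₂ eq = subst (_≤ _) (≡-sym eq) -a≤b

0≤²  : ∀ a → 0ℚ ≤ a * a
0≤² a with ℚ.≤-total 0ℚ a
... | inj₁ 0≤a = 0≤* 0≤a 0≤a
... | inj₂ a≤0 = subst (0ℚ ≤_) (neg² a) (0≤* (ℚ.neg-antimono-≤ a≤0) (ℚ.neg-antimono-≤ a≤0))
  where
  neg² : ∀ a → (- a) * (- a) ≡ a * a
  neg² = solve-∀ ring

∣∣²≡² : ∀ a → ∣ a ∣ * ∣ a ∣ ≡ a * a
∣∣²≡² a = trans (≡-sym (ℚ.∣p*q∣≡∣p∣*∣q∣ a a)) (ℚ.0≤p⇒∣p∣≡p (0≤² a))


^-nonneg : ∀ {a} k → 0ℚ ≤ a → 0ℚ ≤ a ^ℚ k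
^-nonneg zero    0≤a = 0≤1
^-nonneg (suc k) 0≤a = 0≤* 0≤a (^-nonneg k 0≤a)

^-pos : ∀ {a} k → 0ℚ < a → 0ℚ < a ^ℚ k
^-pos zero    0<a = 0<1
^-pos (suc k) 0<a = 0<* 0<a (^-pos k 0<a)

^-mono : ∀ {a b} k → 0ℚ ≤ a → a ≤ b → a ^ℚ k ≤ b ^ℚ k
^-mono zero    0≤a a≤b = ℚ.≤-refl
^-mono (suc k) 0≤a a≤b = *-mono-≤ 0≤a (^-nonneg k 0≤a) a≤b (^-mono k 0≤a a≤b)

^-mono-< : ∀ {a b} k → 0ℚ ≤ a → a < b → a ^ℚ suc k < b ^ℚ suc k
^-mono-< {a} {b} k 0≤a a<b = ℚ.≤-<-trans (*-monoˡ 0≤a (^-mono k 0≤a (ℚ.<⇒≤ a<b)))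
  (ℚ.*-monoˡ-<-pos (b ^ℚ k) {{ℚ.positive (^-pos k (ℚ.≤-<-trans 0≤a a<b))}} a<b)

^-cancel-≤ : ∀ {b a} k → 0ℚ ≤ b → a ^ℚ suc k ≤ b ^ℚ suc k → a ≤ b
^-cancel-≤ {b} {a} k 0≤b le with a ℚ.≤? b
... | yes a≤b = a≤b
... | no  a≰b = contradiction (ℚ.<-≤-trans (^-mono-< k 0≤b (ℚ.≰⇒> a≰b)) le) (ℚ.<-irrefl refl)

^ℚ≡^ : ∀ x k → x ^ℚ k ≡ x Exp.^ k
^ℚ≡^ x zero    = refl
^ℚ≡^ x (suc k) = cong (x *_) (^ℚ≡^ x k)

^-distrib-* : ∀ x y k → (x * y) ^ℚ k ≡ x ^ℚ k * y ^ℚ k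
^-distrib-* x y k = trans (^ℚ≡^ (x * y) k)
  (trans (CExp.^-distrib-* x y k) (≡-sym (cong₂ _*_ (^ℚ≡^ x k) (^ℚ≡^ y k))))

1^ : ∀ k → 1ℚ ^ℚ k ≡ 1ℚ
1^ zero    = refl
1^ (suc k) = trans (ℚ.*-identityˡ _) (1^ k)

^-≤1 : ∀ {a} k → 0ℚ ≤ a → a ≤ 1ℚ → a ^ℚ k ≤ 1ℚ
^-≤1 {a} k 0≤a a≤1 = subst (a ^ℚ k ≤_) (1^ k) (^-mono k 0≤a a≤1)

∣∣≤-from-² : ∀ {a b} → 0ℚ ≤ b → a * a ≤ b * b → ∣ a ∣ ≤ b
∣∣≤-from-² {a} {b} 0≤b le = ^-cancel-≤ 1 0≤b
  (subst₂ _≤_ (trans (≡-sym (∣∣²≡² a)) (sq ∣ a ∣)) (sq b) le)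
  where
  sq : ∀ x → x * x ≡ x * (x * 1ℚ)
  sq = solve-∀ ring

sum-mono : ∀ {f g : Fin n → ℚ} → (∀ i → f i ≤ g i) → sum f ≤ sum g
sum-mono {zero}  f≤g = ℚ.≤-refl
sum-mono {suc n} f≤g = ℚ.+-mono-≤ (f≤g zero) (sum-mono (f≤g ∘ suc))

sum-0 : ∀ n → sum {n} (λ _ → 0ℚ) ≡ 0ℚ
sum-0 zero    = refl
sum-0 (suc n) = trans (ℚ.+-identityˡ _) (sum-0 n)

sum-nonneg : ∀ {f : Fin n → ℚ} → (∀ i → 0ℚ ≤ f i) → 0ℚ ≤ sum f
sum-nonneg {n} {f} 0≤f = subst (_≤ sum f) (sum-0 n) (sum-mono 0≤f)

∣sum∣≤ : ∀ (f : Fin n → ℚ) → ∣ sum f ∣ ≤ sum (λ i → ∣ f i ∣)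
∣sum∣≤ {zero}  f = ℚ.≤-refl
∣sum∣≤ {suc n} f = ℚ.≤-trans (ℚ.∣p+q∣≤∣p∣+∣q∣ (f zero) _) (ℚ.+-monoʳ-≤ ∣ f zero ∣ (∣sum∣≤ (f ∘ suc)))

fromℕ-mkℚ : ∀ m → ℕ→ℚ m ≡ ℚ.mkℚ (ℤ.+ m) 0 (coprime-sym (1-coprimeTo m))
fromℕ-mkℚ m = ℚ.normalize-coprime (coprime-sym (1-coprimeTo m))

fromℕ-+ : ∀ a b → ℕ→ℚ (a ℕ.+ b) ≡ ℕ→ℚ a + ℕ→ℚ b
fromℕ-+ a b rewrite fromℕ-mkℚ a | fromℕ-mkℚ b =
  cong (ℚ._/ 1) (≡-sym (cong₂ ℤ._+_ (ℤ.*-identityʳ (ℤ.+ a)) (ℤ.*-identityʳ (ℤ.+ b))))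

fromℕ-* : ∀ a b → ℕ→ℚ (a ℕ.* b) ≡ ℕ→ℚ a * ℕ→ℚ b
fromℕ-* a b rewrite fromℕ-mkℚ a | fromℕ-mkℚ b = cong (ℚ._/ 1) (ℤ.pos-* a b)

0≤fromℕ : ∀ m → 0ℚ ≤ ℕ→ℚ m
0≤fromℕ m = ℚ.nonNegative⁻¹ _ {{ℚ.normalize-nonNeg m 1}}

fromℕ-mono : ∀ {a b} → a ℕ.≤ b → ℕ→ℚ a ≤ ℕ→ℚ b
fromℕ-mono {a} {b} a≤b with ℕ.m≤n⇒∃[o]m+o≡n a≤b
... | o , refl = subst₂ _≤_ (ℚ.+-identityʳ _) (≡-sym (fromℕ-+ a o)) (ℚ.+-monoʳ-≤ (ℕ→ℚ a) (0≤fromℕ o))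

fromℕ-suc : ∀ m → ℕ→ℚ (suc m) ≡ 1ℚ + ℕ→ℚ m
fromℕ-suc m = fromℕ-+ 1 m

fromℕ-cancel-< : ∀ {a b} → ℕ→ℚ a < ℕ→ℚ b → a ℕ.< b
fromℕ-cancel-< {a} {b} lt = ℕ.≰⇒> λ b≤a → ℚ.<-irrefl refl (ℚ.<-≤-trans lt (fromℕ-mono b≤a))

fromℕ-^ : ∀ a k → ℕ→ℚ (a ℕ.^ k) ≡ ℕ→ℚ a ^ℚ k
fromℕ-^ a zero    = refl
fromℕ-^ a (suc k) = trans (fromℕ-* a (a ℕ.^ k)) (cong (ℕ→ℚ a *_) (fromℕ-^ a k))

fromℕ-Σv : ∀ n (f : Fin n → ℕ) → ℕ→ℚ (Σv n f) ≡ sum (ℕ→ℚ ∘ f)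
fromℕ-Σv zero    f = refl
fromℕ-Σv (suc n) f = trans (fromℕ-+ (f zero) _) (cong (ℕ→ℚ (f zero) +_) (fromℕ-Σv n (f ∘ suc)))

sum-const : ∀ n c → sum {n} (λ _ → c) ≡ ℕ→ℚ n * c
sum-const zero    c = ≡-sym (ℚ.*-zeroˡ c)
sum-const (suc n) c = begin
  c + sum {n} (λ _ → c)    ≡⟨ cong (c +_) (sum-const n c) ⟩
  c + ℕ→ℚ n * c            ≡⟨ factor c (ℕ→ℚ n) ⟩
  (1ℚ + ℕ→ℚ n) * c         ≡⟨ cong (_* c) (fromℕ-suc n) ⟨
  ℕ→ℚ (suc n) * c          ∎
  where
  open ≡-Reasoning
  factor : ∀ c m → c + m * c ≡ (1ℚ + m) * c
  factor = solve-∀ ring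

archimedean : ∀ x → ∃ λ m → x ≤ ℕ→ℚ m
archimedean x@(ℚ.mkℚ (ℤ.+ m) d c) = m , subst (x ≤_) (≡-sym (fromℕ-mkℚ m))
  (ℚ.*≤* (ℤ.*-monoˡ-≤-nonNeg (ℤ.+ m) (ℤ.+≤+ (s≤s z≤n))))
archimedean (ℚ.mkℚ ℤ.-[1+ m ] d c) = 0 , ℚ.<⇒≤ (ℚ.negative⁻¹ _)

floor-bounds : ∀ x → 0ℚ ≤ x → ∃ λ q → ℕ→ℚ q ≤ x × x ≤ ℕ→ℚ q + 1ℚ
floor-bounds x 0≤x = search (proj₁ (archimedean x)) (proj₂ (archimedean x))
  where
  search : ∀ m → x ≤ ℕ→ℚ m → ∃ λ q → ℕ→ℚ q ≤ x × x ≤ ℕ→ℚ q + 1ℚ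
  search zero    x≤m = 0 , 0≤x , ℚ.≤-trans x≤m 0≤1
  search (suc m) x≤m with ℕ→ℚ m ℚ.≤? x
  ... | yes m≤x = m , m≤x , subst (x ≤_) (trans (fromℕ-suc m) (ℚ.+-comm 1ℚ (ℕ→ℚ m))) x≤m
  ... | no  m≰x = search m (ℚ.<⇒≤ (ℚ.≰⇒> m≰x))

-- Bernoulli's inequality.
1-k*δ≤[1-δ]^k : ∀ k {δ} → 0ℚ ≤ δ → δ ≤ 1ℚ → 1ℚ - ℕ→ℚ k * δ ≤ (1ℚ - δ) ^ℚ k
1-k*δ≤[1-δ]^k zero    {δ} 0≤δ δ≤1 = ≤-from-slack ℚ.≤-refl (slack δ)
  where
  slack : ∀ δ → 1ℚ - (1ℚ - 0ℚ * δ) ≡ 0ℚ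
  slack = solve-∀ ring
1-k*δ≤[1-δ]^k (suc k) {δ} 0≤δ δ≤1 = begin
  1ℚ - ℕ→ℚ (suc k) * δ          ≡⟨ cong (λ m → 1ℚ - m * δ) (fromℕ-suc k) ⟩
  1ℚ - (1ℚ + ℕ→ℚ k) * δ         ≤⟨ ≤-from-slack (0≤* (0≤fromℕ k) (0≤² δ)) (slack δ (ℕ→ℚ k)) ⟩
  (1ℚ - δ) * (1ℚ - ℕ→ℚ k * δ)   ≤⟨ *-monoˡ (≤⇒0≤- δ≤1) (1-k*δ≤[1-δ]^k k 0≤δ δ≤1) ⟩
  (1ℚ - δ) ^ℚ suc k             ∎
  where
  open ℚ.≤-Reasoning
  slack : ∀ δ m → (1ℚ - δ) * (1ℚ - m * δ) - (1ℚ - (1ℚ + m) * δ) ≡ m * (δ * δ)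
  slack = solve-∀ ring

-- Symmetric matrices

-- Log-convexity makes the ratios `s (suc j) / s j` nondecreasing, hence at least the first of them.
-- The form is free of division because terms may vanish; if `s j` is zero, convexity makes
-- `s (suc j)` zero too.
logconvex-step : ∀ (s : ℕ → ℚ) → (∀ j → 0ℚ ≤ s j) →
  (∀ j → s (suc j) * s (suc j) ≤ s j * s (suc (suc j))) → ∀ j → s 1 * s j ≤ s 0 * s (suc j)
logconvex-step s 0≤s convex zero    = ℚ.≤-reflexive (ℚ.*-comm (s 1) (s 0))
logconvex-step s 0≤s convex (suc j) with s j ℚ.≤? 0ℚ
... | no sj≰0 = *-cancelʳ (ℚ.≰⇒> sj≰0) (begin
  s 1 * s (suc j) * s j               ≡⟨ swap (s 1) (s (suc j)) (s j) ⟩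
  s (suc j) * (s 1 * s j)             ≤⟨ *-monoˡ (0≤s (suc j)) (logconvex-step s 0≤s convex j) ⟩
  s (suc j) * (s 0 * s (suc j))       ≡⟨ ℚ.*-assoc (s (suc j)) (s 0) (s (suc j)) ⟨
  s (suc j) * s 0 * s (suc j)         ≡⟨ swap′ (s (suc j)) (s 0) ⟩
  s 0 * (s (suc j) * s (suc j))       ≤⟨ *-monoˡ (0≤s 0) (convex j) ⟩
  s 0 * (s j * s (suc (suc j)))       ≡⟨ swap″ (s 0) (s j) (s (suc (suc j))) ⟩
  s 0 * s (suc (suc j)) * s j         ∎)
  where
  open ℚ.≤-Reasoning
  swap : ∀ a b c → a * b * c ≡ b * (a * c)
  swap = solve-∀ ring
  swap′ : ∀ a b → a * b * a ≡ b * (a * a)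
  swap′ = solve-∀ ring
  swap″ : ∀ a b c → a * (b * c) ≡ a * c * b
  swap″ = solve-∀ ring
... | yes sj≤0 = subst (_≤ s 0 * s (suc (suc j))) (≡-sym vanish) (0≤* (0≤s 0) (0≤s (suc (suc j))))
  where
  open ℚ.≤-Reasoning
  square≤0 : s (suc j) * s (suc j) ≤ 0ℚ * 0ℚ
  square≤0 = begin
    s (suc j) * s (suc j)   ≤⟨ convex j ⟩
    s j * s (suc (suc j))   ≤⟨ *-monoʳ (0≤s (suc (suc j))) sj≤0 ⟩
    0ℚ * s (suc (suc j))    ≡⟨ ℚ.*-zeroˡ (s (suc (suc j))) ⟩
    0ℚ * 0ℚ                 ∎
  s≡0 : s (suc j) ≡ 0ℚ
  s≡0 = ℚ.∣p∣≡0⇒p≡0 _ (ℚ.≤-antisym (∣∣≤-from-² ℚ.≤-refl square≤0) (ℚ.0≤∣p∣ (s (suc j))))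
  vanish : s 1 * s (suc j) ≡ 0ℚ
  vanish = trans (cong (s 1 *_) s≡0) (ℚ.*-zeroʳ (s 1))

-- The product of the ratios up to `s (suc j)` is at least the matching power of the first ratio,
-- that is `(s 1 / s 0)^(j+1) ≤ s (j+1) / s 0` cleared of denominators.
logconvex-power : ∀ (s : ℕ → ℚ) → (∀ j → 0ℚ ≤ s j) →
  (∀ j → s (suc j) * s (suc j) ≤ s j * s (suc (suc j))) → ∀ j → s 1 ^ℚ suc j ≤ s (suc j) * s 0 ^ℚ j
logconvex-power s 0≤s convex zero    = ℚ.≤-refl
logconvex-power s 0≤s convex (suc j) = begin
  s 1 * s 1 ^ℚ suc j                     ≤⟨ *-monoˡ (0≤s 1) (logconvex-power s 0≤s convex j) ⟩
  s 1 * (s (suc j) * s 0 ^ℚ j)           ≡⟨ ℚ.*-assoc (s 1) (s (suc j)) (s 0 ^ℚ j) ⟨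
  s 1 * s (suc j) * s 0 ^ℚ j             ≤⟨ *-monoʳ (^-nonneg j (0≤s 0)) (logconvex-step s 0≤s convex (suc j)) ⟩
  s 0 * s (suc (suc j)) * s 0 ^ℚ j       ≡⟨ swap (s 0) (s (suc (suc j))) (s 0 ^ℚ j) ⟩
  s (suc (suc j)) * (s 0 * s 0 ^ℚ j)     ∎
  where
  open ℚ.≤-Reasoning
  swap : ∀ a b c → a * b * c ≡ b * (a * c)
  swap = solve-∀ ring

⟨_,_⟩ : (Fin n → ℚ) → (Fin n → ℚ) → ℚ
⟨ x , y ⟩ = sum (λ i → x i * y i)

one : Fin n → ℚ
one _ = 1ℚ

0≤norm : ∀ (x : Fin n → ℚ) → 0ℚ ≤ ⟨ x , x ⟩
0≤norm x = sum-nonneg (λ i → 0≤² (x i))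

sum-product : ∀ (f g : Fin n → ℚ) → sum (λ i → sum (λ j → f i * g j)) ≡ sum f * sum g
sum-product f g = trans (sum-cong-≗ λ i → ≡-sym (*-distribˡ-sum (f i) g)) (≡-sym (*-distribʳ-sum (sum g) f))

sum²-+ : ∀ (F H : Fin n → Fin n → ℚ) →
  sum (λ i → sum (λ j → F i j + H i j)) ≡ sum (λ i → sum (F i)) + sum (λ i → sum (H i))
sum²-+ F H = trans (sum-cong-≗ λ i → ∑-distrib-+ (F i) (H i)) (∑-distrib-+ (λ i → sum (F i)) (λ i → sum (H i)))

-- Lagrange's identity: the defect is half of Σᵢⱼ (xᵢ yⱼ − xⱼ yᵢ)².
cauchy-schwarz : ∀ (x y : Fin n → ℚ) → ⟨ x , y ⟩ * ⟨ x , y ⟩ ≤ ⟨ x , x ⟩ * ⟨ y , y ⟩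
cauchy-schwarz {n} x y = *-cancelʳ {c = 2ℚ} (ℚ.positive⁻¹ 2ℚ)
  (≤-from-slack (sum-nonneg λ i → sum-nonneg λ j → 0≤² (d i j)) defect)
  where
  open ≡-Reasoning
  d : Fin n → Fin n → ℚ
  d i j = x i * y j - x j * y i
  S = ⟨ x , y ⟩
  pointwise : ∀ a b c d → (a * d - c * b) * (a * d - c * b) + (a * b * (c * d) + a * b * (c * d)) ≡ a * a * (d * d) + b * b * (c * c)
  pointwise = solve-∀ ring
  lagrange : sum (λ i → sum (λ j → d i j * d i j)) + (S * S + S * S) ≡ ⟨ x , x ⟩ * ⟨ y , y ⟩ + ⟨ y , y ⟩ * ⟨ x , x ⟩
  lagrange = begin
    sum (λ i → sum (λ j → d i j * d i j)) + (S * S + S * S)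
      ≡⟨ cong (λ t → sum (λ i → sum (λ j → d i j * d i j)) + (t + t)) (sum-product (λ i → x i * y i) (λ i → x i * y i)) ⟨
    sum (λ i → sum (λ j → d i j * d i j)) + (sum (λ i → sum (λ j → p i j)) + sum (λ i → sum (λ j → p i j)))
      ≡⟨ cong (sum (λ i → sum (λ j → d i j * d i j)) +_) (sum²-+ p p) ⟨
    sum (λ i → sum (λ j → d i j * d i j)) + sum (λ i → sum (λ j → p i j + p i j))
      ≡⟨ sum²-+ (λ i j → d i j * d i j) (λ i j → p i j + p i j) ⟨
    sum (λ i → sum (λ j → d i j * d i j + (p i j + p i j)))
      ≡⟨ (sum-cong-≗ λ i → sum-cong-≗ λ j → pointwise (x i) (y i) (x j) (y j)) ⟩
    sum (λ i → sum (λ j → x i * x i * (y j * y j) + y i * y i * (x j * x j)))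
      ≡⟨ sum²-+ (λ i j → x i * x i * (y j * y j)) (λ i j → y i * y i * (x j * x j)) ⟩
    sum (λ i → sum (λ j → x i * x i * (y j * y j))) + sum (λ i → sum (λ j → y i * y i * (x j * x j)))
      ≡⟨ cong₂ _+_ (sum-product (λ i → x i * x i) (λ i → y i * y i)) (sum-product (λ i → y i * y i) (λ i → x i * x i)) ⟩
    ⟨ x , x ⟩ * ⟨ y , y ⟩ + ⟨ y , y ⟩ * ⟨ x , x ⟩ ∎
    where
    p : Fin n → Fin n → ℚ
    p i j = x i * y i * (x j * y j)
  rearrange : ∀ X Y S L → X * Y * 2ℚ - S * S * 2ℚ ≡ (X * Y + Y * X) - (L + (S * S + S * S)) + L
  rearrange = solve-∀ ring
  defect : ⟨ x , x ⟩ * ⟨ y , y ⟩ * 2ℚ - S * S * 2ℚ ≡ sum (λ i → sum (λ j → d i j * d i j))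
  defect = begin
    ⟨ x , x ⟩ * ⟨ y , y ⟩ * 2ℚ - S * S * 2ℚ ≡⟨ rearrange ⟨ x , x ⟩ ⟨ y , y ⟩ S L ⟩
    (⟨ x , x ⟩ * ⟨ y , y ⟩ + ⟨ y , y ⟩ * ⟨ x , x ⟩) - (L + (S * S + S * S)) + L
      ≡⟨ cong (λ t → (⟨ x , x ⟩ * ⟨ y , y ⟩ + ⟨ y , y ⟩ * ⟨ x , x ⟩) - t + L) lagrange ⟩
    (⟨ x , x ⟩ * ⟨ y , y ⟩ + ⟨ y , y ⟩ * ⟨ x , x ⟩) - (⟨ x , x ⟩ * ⟨ y , y ⟩ + ⟨ y , y ⟩ * ⟨ x , x ⟩) + L
      ≡⟨ cong (_+ L) (ℚ.+-inverseʳ (⟨ x , x ⟩ * ⟨ y , y ⟩ + ⟨ y , y ⟩ * ⟨ x , x ⟩)) ⟩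
    0ℚ + L ≡⟨ ℚ.+-identityˡ L ⟩
    L ∎
    where L = sum (λ i → sum (λ j → d i j * d i j))

apply : (Fin n → Fin n → ℚ) → (Fin n → ℚ) → Fin n → ℚ
apply a z v = sum (λ w → a v w * z w)

power : (Fin n → Fin n → ℚ) → ℕ → (Fin n → ℚ) → Fin n → ℚ
power a zero    z = z
power a (suc j) z = apply a (power a j z)

norms : (Fin n → Fin n → ℚ) → (Fin n → ℚ) → ℕ → ℚ
norms a z j = ⟨ power a j z , power a j z ⟩

∣apply∣≤ : ∀ (a : Fin n → Fin n → ℚ) z v → (∀ w → 0ℚ ≤ a v w) → (∀ i → ∣ z i ∣ ≤ 1ℚ) →
  ∣ apply a z v ∣ ≤ sum (a v)
∣apply∣≤ a z v 0≤a ∣z∣≤1 = ℚ.≤-trans (∣sum∣≤ (λ w → a v w * z w)) (sum-mono λ w → begin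
  ∣ a v w * z w ∣         ≡⟨ ℚ.∣p*q∣≡∣p∣*∣q∣ (a v w) (z w) ⟩
  ∣ a v w ∣ * ∣ z w ∣     ≡⟨ cong (_* ∣ z w ∣) (ℚ.0≤p⇒∣p∣≡p (0≤a w)) ⟩
  a v w * ∣ z w ∣         ≤⟨ *-monoˡ (0≤a w) (∣z∣≤1 w) ⟩
  a v w * 1ℚ              ≡⟨ ℚ.*-identityʳ (a v w) ⟩
  a v w                   ∎)
  where open ℚ.≤-Reasoning

module Symmetric (a : Fin n → Fin n → ℚ) (a-sym : ∀ i j → a i j ≡ a j i) where

  apply-selfadjoint : ∀ x y → ⟨ apply a x , y ⟩ ≡ ⟨ x , apply a y ⟩
  apply-selfadjoint x y = begin
    sum (λ v → apply a x v * y v)                 ≡⟨ sum-cong-≗ (λ v → *-distribʳ-sum (y v) (λ w → a v w * x w)) ⟩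
    sum (λ v → sum (λ w → a v w * x w * y v))     ≡⟨ ∑-comm (λ v w → a v w * x w * y v) ⟩
    sum (λ w → sum (λ v → a v w * x w * y v))     ≡⟨ (sum-cong-≗ λ w → sum-cong-≗ λ v → trans (cong (λ t → t * x w * y v) (a-sym v w)) (swap (a w v) (x w) (y v))) ⟩
    sum (λ w → sum (λ v → x w * (a w v * y v)))   ≡⟨ sum-cong-≗ (λ w → *-distribˡ-sum (x w) (λ v → a w v * y v)) ⟨
    ⟨ x , apply a y ⟩                             ∎
    where
    open ≡-Reasoning
    swap : ∀ a x y → a * x * y ≡ x * (a * y)
    swap = solve-∀ ring

  -- By symmetry `|A^(j+1) z|²` is the inner product of `A^j z` and `A^(j+2) z`, to which
  -- Cauchy-Schwarz applies. This replaces any use of the spectrum.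
  norms-convex : ∀ z j → norms a z (suc j) * norms a z (suc j) ≤ norms a z j * norms a z (suc (suc j))
  norms-convex z j = begin
    norms a z (suc j) * norms a z (suc j)
      ≡⟨ cong₂ _*_ (apply-selfadjoint (power a j z) (power a (suc j) z)) (apply-selfadjoint (power a j z) (power a (suc j) z)) ⟩
    ⟨ power a j z , power a (suc (suc j)) z ⟩ * ⟨ power a j z , power a (suc (suc j)) z ⟩
      ≤⟨ cauchy-schwarz (power a j z) (power a (suc (suc j)) z) ⟩
    norms a z j * norms a z (suc (suc j)) ∎
    where open ℚ.≤-Reasoning

  norms-power : ∀ z j → norms a z 1 ^ℚ suc j ≤ norms a z (suc j) * norms a z 0 ^ℚ j
  norms-power z = logconvex-power (norms a z) (λ j → 0≤norm (power a j z)) (norms-convex z)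

-- M stands for the 0/1 matrix counting non-backtracking walks of length suc k′; D is the
-- reference degree, D′ the average degree of a, and ν the order.
module Mixing {n} (a M : Fin n → Fin n → ℚ) (a-sym : ∀ i j → a i j ≡ a j i) (k′ : ℕ)
  (ν D D′ β κ τ ρ e : ℚ)
  (ν≡n : ν ≡ ℕ→ℚ n) (0<ν : 0ℚ < ν) (0≤D : 0ℚ ≤ D) (0≤κ : 0ℚ ≤ κ) (0≤e : 0ℚ ≤ e)
  (0≤β : 0ℚ ≤ β) (β≤1 : β ≤ 1ℚ)
  (0≤M : ∀ v w → 0ℚ ≤ M v w) (M≤1 : ∀ v w → M v w ≤ 1ℚ)
  (power≈M : ∀ z → (∀ i → ∣ z i ∣ ≤ 1ℚ) → ∀ v → ∣ power a (suc k′) z v - apply M z v ∣ ≤ β * ν)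
  (total : sum (apply a one) ≡ ν * D′) (D′-large : (1ℚ - τ) * D ≤ D′)
  (D′-power : (1ℚ - ρ) * (ν * ν) ≤ (D′ * D′) ^ℚ suc k′)
  (κ-power : (ρ + (3ℚ * β + 3ℚ * β)) * (ν * ν) ≤ (κ * (D * D)) ^ℚ suc k′)
  (1+κ-power : (1ℚ + 3ℚ * β) * (ν * ν) ≤ ((1ℚ + κ) * (D * D)) ^ℚ suc k′)
  (e-large : κ + 2ℚ * τ ≤ e * e)
  where

  open Symmetric a a-sym
  open ℚ.≤-Reasoning

  0≤ν : 0ℚ ≤ ν
  0≤ν = ℚ.<⇒≤ 0<ν

  sum-const-ν : ∀ c → sum {n} (λ _ → c) ≡ ν * c
  sum-const-ν c = trans (sum-const n c) (cong (_* c) (≡-sym ν≡n))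

  rowsum : Fin n → ℚ
  rowsum v = sum (M v)

  R : ℚ
  R = sum rowsum

  rowsum≤ν : ∀ v → rowsum v ≤ ν
  rowsum≤ν v = begin
    sum (M v)            ≤⟨ sum-mono (M≤1 v) ⟩
    sum {n} (λ _ → 1ℚ)   ≡⟨ sum-const-ν 1ℚ ⟩
    ν * 1ℚ               ≡⟨ ℚ.*-identityʳ ν ⟩
    ν                    ∎

  -- The entries of `A^k z` are at most `q + β ν` in absolute value. In the square, one factor `q`
  -- is replaced by its bound `ν`, so that only the sum of `q` is needed and not the sum of its
  -- squares.
  norms-bound : ∀ z (q : Fin n → ℚ) → (∀ i → ∣ z i ∣ ≤ 1ℚ) → (∀ v → ∣ apply M z v ∣ ≤ q v) → (∀ v → q v ≤ ν) →
    norms a z (suc k′) ≤ ν * sum q + 3ℚ * β * (ν * ν * ν)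
  norms-bound z q ∣z∣≤1 Mz≤q q≤ν = begin
    sum (λ v → p v * p v)                            ≤⟨ sum-mono entry ⟩
    sum (λ v → ν * q v + 3ℚ * β * (ν * ν))           ≡⟨ ∑-distrib-+ (λ v → ν * q v) (λ _ → 3ℚ * β * (ν * ν)) ⟩
    sum (λ v → ν * q v) + sum {n} (λ v → 3ℚ * β * (ν * ν))
      ≡⟨ cong₂ _+_ (≡-sym (*-distribˡ-sum ν q)) (sum-const-ν (3ℚ * β * (ν * ν))) ⟩
    ν * sum q + ν * (3ℚ * β * (ν * ν))               ≡⟨ cong (ν * sum q +_) (rearrange ν β) ⟩
    ν * sum q + 3ℚ * β * (ν * ν * ν)                 ∎
    where
    p = power a (suc k′) z
    rearrange : ∀ ν β → ν * (3ℚ * β * (ν * ν)) ≡ 3ℚ * β * (ν * ν * ν)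
    rearrange = solve-∀ ring
    split : ∀ p m → p ≡ m + (p - m)
    split = solve-∀ ring
    slack : ∀ ν q β → ν * q + 3ℚ * β * (ν * ν) - (q + β * ν) * (q + β * ν)
                    ≡ q * (ν - q) + 2ℚ * (β * ν) * (ν - q) + β * (ν * ν) * (1ℚ - β)
    slack = solve-∀ ring
    entry : ∀ v → p v * p v ≤ ν * q v + 3ℚ * β * (ν * ν)
    entry v = begin
      p v * p v                          ≡⟨ ∣∣²≡² (p v) ⟨
      ∣ p v ∣ * ∣ p v ∣                  ≤⟨ *-mono-≤ (ℚ.0≤∣p∣ (p v)) (ℚ.0≤∣p∣ (p v)) ∣p∣≤ ∣p∣≤ ⟩
      (q v + β * ν) * (q v + β * ν)      ≤⟨ ≤-from-slack (0≤+ (0≤+ (0≤* 0≤q (≤⇒0≤- (q≤ν v)))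
                                              (0≤* (0≤* (ℚ.nonNegative⁻¹ 2ℚ) (0≤* 0≤β 0≤ν)) (≤⇒0≤- (q≤ν v))))
                                              (0≤* (0≤* 0≤β (0≤* 0≤ν 0≤ν)) (≤⇒0≤- β≤1))) (slack ν (q v) β) ⟩
      ν * q v + 3ℚ * β * (ν * ν)         ∎
      where
      0≤q : 0ℚ ≤ q v
      0≤q = ℚ.≤-trans (ℚ.0≤∣p∣ (apply M z v)) (Mz≤q v)
      ∣p∣≤ : ∣ p v ∣ ≤ q v + β * ν
      ∣p∣≤ = begin
        ∣ p v ∣                                            ≡⟨ cong ∣_∣ (split (p v) (apply M z v)) ⟩
        ∣ apply M z v + (p v - apply M z v) ∣              ≤⟨ ℚ.∣p+q∣≤∣p∣+∣q∣ (apply M z v) _ ⟩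
        ∣ apply M z v ∣ + ∣ p v - apply M z v ∣            ≤⟨ ℚ.+-mono-≤ (Mz≤q v) (power≈M z ∣z∣≤1 v) ⟩
        q v + β * ν                                        ∎

  ∣one∣≤1 : ∀ i → ∣ one {n} i ∣ ≤ 1ℚ
  ∣one∣≤1 i = ℚ.≤-refl

  Mone≤rowsum : ∀ v → ∣ apply M one v ∣ ≤ rowsum v
  Mone≤rowsum v = ∣apply∣≤ M one v (0≤M v) ∣one∣≤1

  norm-one : norms a one 0 ≡ ν
  norm-one = trans (sum-const-ν (1ℚ * 1ℚ)) (ℚ.*-identityʳ ν)

  -- Cauchy-Schwarz against `one`: the row sums have average `D′`, so their mean square is at least
  -- `D′²`.
  νD′²≤norm : ν * (D′ * D′) ≤ norms a one 1
  νD′²≤norm = *-cancelʳ 0<ν (begin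
    ν * (D′ * D′) * ν                         ≡⟨ rearrange ν D′ ⟩
    (ν * D′) * (ν * D′)                       ≡⟨ cong₂ _*_ total total ⟨
    sum (apply a one) * sum (apply a one)     ≡⟨ cong₂ _*_ inner inner ⟨
    ⟨ apply a one , one ⟩ * ⟨ apply a one , one ⟩ ≤⟨ cauchy-schwarz (apply a one) one ⟩
    norms a one 1 * norms a one 0             ≡⟨ cong (norms a one 1 *_) norm-one ⟩
    norms a one 1 * ν                         ∎)
    where
    rearrange : ∀ ν d → ν * (d * d) * ν ≡ (ν * d) * (ν * d)
    rearrange = solve-∀ ring
    inner : ⟨ apply a one , one ⟩ ≡ sum (apply a one)
    inner = sum-cong-≗ (λ v → ℚ.*-identityʳ (apply a one v))

  0≤D′² : 0ℚ ≤ D′ * D′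
  0≤D′² = 0≤² D′

  -- Log-convexity raises `ν D′² ≤ |A 1|²` to `ν (D′²)^k ≤ |A^k 1|²`, and `norms-bound` with the row
  -- sums of `M` bounds the right side by `ν R + 3 β ν³`. Hence `M` carries nearly all of the mass
  -- `ν²`.
  R-large : (1ℚ - ρ) * (ν * ν) ≤ R + 3ℚ * β * (ν * ν)
  R-large = *-cancelʳ (^-pos (suc k′) 0<ν) (begin
    (1ℚ - ρ) * (ν * ν) * ν ^ℚ suc k′        ≤⟨ *-monoʳ (^-nonneg (suc k′) 0≤ν) D′-power ⟩
    (D′ * D′) ^ℚ suc k′ * ν ^ℚ suc k′       ≡⟨ ^-distrib-* (D′ * D′) ν (suc k′) ⟨
    (D′ * D′ * ν) ^ℚ suc k′                 ≤⟨ ^-mono (suc k′) (0≤* 0≤D′² 0≤ν) (subst (_≤ norms a one 1) (ℚ.*-comm ν (D′ * D′)) νD′²≤norm) ⟩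
    norms a one 1 ^ℚ suc k′                 ≤⟨ norms-power one k′ ⟩
    norms a one (suc k′) * norms a one 0 ^ℚ k′ ≡⟨ cong (λ t → norms a one (suc k′) * t ^ℚ k′) norm-one ⟩
    norms a one (suc k′) * ν ^ℚ k′          ≤⟨ *-monoʳ (^-nonneg k′ 0≤ν) (norms-bound one rowsum ∣one∣≤1 Mone≤rowsum rowsum≤ν) ⟩
    (ν * R + 3ℚ * β * (ν * ν * ν)) * ν ^ℚ k′ ≡⟨ rearrange ν R β (ν ^ℚ k′) ⟩
    (R + 3ℚ * β * (ν * ν)) * (ν * ν ^ℚ k′)  ∎)
    where
    rearrange : ∀ ν r β p → (ν * r + 3ℚ * β * (ν * ν * ν)) * p ≡ (r + 3ℚ * β * (ν * ν)) * (ν * p)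
    rearrange = solve-∀ ring

  norm≤ν : ∀ (z : Fin n → ℚ) → (∀ i → ∣ z i ∣ ≤ 1ℚ) → ⟨ z , z ⟩ ≤ ν
  norm≤ν z ∣z∣≤1 = begin
    sum (λ i → z i * z i)   ≤⟨ sum-mono (λ i → subst (_≤ 1ℚ) (∣∣²≡² (z i)) (*-mono-≤ (ℚ.0≤∣p∣ (z i)) (ℚ.0≤∣p∣ (z i)) (∣z∣≤1 i) (∣z∣≤1 i))) ⟩
    sum {n} (λ _ → 1ℚ)      ≡⟨ sum-const-ν 1ℚ ⟩
    ν * 1ℚ                  ≡⟨ ℚ.*-identityʳ ν ⟩
    ν                       ∎

  -- Descends from length `k` to length 1: since `|z|² ≤ ν`, log-convexity gives `|A z|^(2k) ≤ |A^k
  -- z|² ν^(k-1) ≤ c ν^(k+2)`. The condition on `λ′` is what makes the `k`-th root of this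
  -- available.
  norm₁-bound : ∀ z {c λ′} → (∀ i → ∣ z i ∣ ≤ 1ℚ) → 0ℚ ≤ λ′ → norms a z (suc k′) ≤ c * (ν * ν * ν) →
    c * (ν * ν) ≤ (λ′ * (D * D)) ^ℚ suc k′ → norms a z 1 ≤ λ′ * (D * D) * ν
  norm₁-bound z {c} {λ′} ∣z∣≤1 0≤λ norm≤ c≤ = ^-cancel-≤ k′ (0≤* (0≤* 0≤λ (0≤² D)) 0≤ν) (begin
    norms a z 1 ^ℚ suc k′                        ≤⟨ norms-power z k′ ⟩
    norms a z (suc k′) * norms a z 0 ^ℚ k′       ≤⟨ *-mono-≤ (0≤norm (power a (suc k′) z)) (^-nonneg k′ (0≤norm z)) norm≤ (^-mono k′ (0≤norm z) (norm≤ν z ∣z∣≤1)) ⟩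
    c * (ν * ν * ν) * ν ^ℚ k′                    ≡⟨ rearrange c ν (ν ^ℚ k′) ⟩
    c * (ν * ν) * ν ^ℚ suc k′                    ≤⟨ *-monoʳ (^-nonneg (suc k′) 0≤ν) c≤ ⟩
    (λ′ * (D * D)) ^ℚ suc k′ * ν ^ℚ suc k′       ≡⟨ ^-distrib-* (λ′ * (D * D)) ν (suc k′) ⟨
    (λ′ * (D * D) * ν) ^ℚ suc k′                 ∎)
    where
    rearrange : ∀ c ν p → c * (ν * ν * ν) * p ≡ c * (ν * ν) * (ν * p)
    rearrange = solve-∀ ring

  -- On vectors orthogonal to 1 the matrix M acts as M − J, whose entries sum to o(ν²) in absolute value.
  norm-orthogonal : ∀ z → (∀ i → ∣ z i ∣ ≤ 1ℚ) → sum z ≡ 0ℚ → norms a z 1 ≤ κ * (D * D) * ν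
  norm-orthogonal z ∣z∣≤1 Σz≡0 = norm₁-bound z {c = ρ + (3ℚ * β + 3ℚ * β)} ∣z∣≤1 0≤κ bound κ-power
    where
    J-M : Fin n → Fin n → ℚ
    J-M v w = 1ℚ - M v w
    -- `q v` is the mass missing from row `v` of `M`. By `R-large` at most `(ρ + 3 β) ν²` is missing
    -- in all; the second `3 β` comes from `norms-bound`.
    q : Fin n → ℚ
    q v = sum (J-M v)
    cancel : ∀ m → 1ℚ - m + m ≡ 1ℚ
    cancel = solve-∀ ring
    q+rowsum : ∀ v → q v + rowsum v ≡ ν
    q+rowsum v = begin-equality
      q v + rowsum v                     ≡⟨ ∑-distrib-+ (J-M v) (M v) ⟨
      sum (λ w → 1ℚ - M v w + M v w)     ≡⟨ sum-cong-≗ (λ w → cancel (M v w)) ⟩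
      sum {n} (λ _ → 1ℚ)                 ≡⟨ sum-const-ν 1ℚ ⟩
      ν * 1ℚ                             ≡⟨ ℚ.*-identityʳ ν ⟩
      ν                                  ∎
    q≤ν : ∀ v → q v ≤ ν
    q≤ν v = ≤-from-slack (sum-nonneg (0≤M v)) (trans (cong (_- q v) (≡-sym (q+rowsum v))) (diff (q v) (rowsum v)))
      where
      diff : ∀ q r → q + r - q ≡ r
      diff = solve-∀ ring
    Σq : sum q + R ≡ ν * ν
    Σq = trans (≡-sym (∑-distrib-+ q rowsum)) (trans (sum-cong-≗ q+rowsum) (sum-const-ν ν))
    Mz≡ : ∀ v → apply M z v ≡ - apply J-M z v
    Mz≡ v = begin-equality
      apply M z v                                         ≡⟨ cancel′ (apply M z v) (apply J-M z v) ⟩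
      - apply J-M z v + (apply J-M z v + apply M z v)     ≡⟨ cong (- apply J-M z v +_) J ⟩
      - apply J-M z v + 0ℚ                                ≡⟨ ℚ.+-identityʳ _ ⟩
      - apply J-M z v                                     ∎
      where
      cancel′ : ∀ x y → x ≡ - y + (y + x)
      cancel′ = solve-∀ ring
      entry : ∀ m z → (1ℚ - m) * z + m * z ≡ z
      entry = solve-∀ ring
      J : apply J-M z v + apply M z v ≡ 0ℚ
      J = begin-equality
        apply J-M z v + apply M z v                        ≡⟨ ∑-distrib-+ (λ w → J-M v w * z w) (λ w → M v w * z w) ⟨
        sum (λ w → (1ℚ - M v w) * z w + M v w * z w)       ≡⟨ sum-cong-≗ (λ w → entry (M v w) (z w)) ⟩
        sum z                                              ≡⟨ Σz≡0 ⟩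
        0ℚ                                                 ∎
    Mz≤q : ∀ v → ∣ apply M z v ∣ ≤ q v
    Mz≤q v = begin
      ∣ apply M z v ∣        ≡⟨ cong ∣_∣ (Mz≡ v) ⟩
      ∣ - apply J-M z v ∣    ≡⟨ ℚ.∣-p∣≡∣p∣ (apply J-M z v) ⟩
      ∣ apply J-M z v ∣      ≤⟨ ∣apply∣≤ J-M z v (λ w → ≤⇒0≤- (M≤1 v w)) ∣z∣≤1 ⟩
      q v                    ∎
    rearrange : ∀ ν r ρ β s → (ρ + (3ℚ * β + 3ℚ * β)) * (ν * ν * ν) - (ν * s + 3ℚ * β * (ν * ν * ν))
        ≡ ν * ((r + 3ℚ * β * (ν * ν)) - (1ℚ - ρ) * (ν * ν)) + ν * (ν * ν - (s + r))
    rearrange = solve-∀ ring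
    slack : (ρ + (3ℚ * β + 3ℚ * β)) * (ν * ν * ν) - (ν * sum q + 3ℚ * β * (ν * ν * ν))
        ≡ ν * ((R + 3ℚ * β * (ν * ν)) - (1ℚ - ρ) * (ν * ν))
    slack = begin-equality
      (ρ + (3ℚ * β + 3ℚ * β)) * (ν * ν * ν) - (ν * sum q + 3ℚ * β * (ν * ν * ν)) ≡⟨ rearrange ν R ρ β (sum q) ⟩
      X + ν * (ν * ν - (sum q + R))    ≡⟨ cong (λ t → X + ν * (ν * ν - t)) Σq ⟩
      X + ν * (ν * ν - ν * ν)          ≡⟨ cong (λ t → X + ν * t) (ℚ.+-inverseʳ (ν * ν)) ⟩
      X + ν * 0ℚ                       ≡⟨ cong (X +_) (ℚ.*-zeroʳ ν) ⟩
      X + 0ℚ                           ≡⟨ ℚ.+-identityʳ X ⟩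
      X                                ∎
      where X = ν * ((R + 3ℚ * β * (ν * ν)) - (1ℚ - ρ) * (ν * ν))
    bound : norms a z (suc k′) ≤ (ρ + (3ℚ * β + 3ℚ * β)) * (ν * ν * ν)
    bound = begin
      norms a z (suc k′)                             ≤⟨ norms-bound z q ∣z∣≤1 Mz≤q q≤ν ⟩
      ν * sum q + 3ℚ * β * (ν * ν * ν)               ≤⟨ ≤-from-slack (0≤* 0≤ν (≤⇒0≤- R-large)) slack ⟩
      (ρ + (3ℚ * β + 3ℚ * β)) * (ν * ν * ν)          ∎

  -- Bounding every row sum of `M` by `ν` is enough here: for `z = 1` the trivial upper bound is
  -- already within a factor close to 1 of the lower bound.
  norm-degree : norms a one 1 ≤ (1ℚ + κ) * (D * D) * ν
  norm-degree = norm₁-bound one {c = 1ℚ + 3ℚ * β} ∣one∣≤1 (0≤+ 0≤1 0≤κ) (begin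
    norms a one (suc k′)                              ≤⟨ norms-bound one (λ _ → ν) ∣one∣≤1 (λ v → ℚ.≤-trans (Mone≤rowsum v) (rowsum≤ν v)) (λ v → ℚ.≤-refl) ⟩
    ν * sum {n} (λ _ → ν) + 3ℚ * β * (ν * ν * ν)      ≡⟨ cong (λ t → ν * t + 3ℚ * β * (ν * ν * ν)) (sum-const-ν ν) ⟩
    ν * (ν * ν) + 3ℚ * β * (ν * ν * ν)                ≡⟨ rearrange ν β ⟩
    (1ℚ + 3ℚ * β) * (ν * ν * ν)                       ∎) 1+κ-power
    where
    rearrange : ∀ ν β → ν * (ν * ν) + 3ℚ * β * (ν * ν * ν) ≡ (1ℚ + 3ℚ * β) * (ν * ν * ν)
    rearrange = solve-∀ ring

  deviation : Fin n → ℚ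
  deviation v = apply a one v - D

  -- Expanding the square leaves `|A 1|² - 2 D ν D′ + ν D²`. With `norm-degree` for the first term
  -- and `D′-large` for the second, the coefficient of `D² ν` is
  -- `(1 + κ) - 2 (1 - τ) + 1 = κ + 2 τ`.
  norm-deviation : ⟨ deviation , deviation ⟩ ≤ (κ + 2ℚ * τ) * (D * D) * ν
  norm-deviation = ≤-from-slack
    (0≤+ (≤⇒0≤- norm-degree) (0≤* (0≤* (ℚ.nonNegative⁻¹ 2ℚ) (0≤* 0≤D 0≤ν)) (≤⇒0≤- D′-large)))
    (begin-equality
      (κ + 2ℚ * τ) * (D * D) * ν - V ≡⟨ rearrange κ τ D D′ ν s₁ V ⟩
      Y + (s₁ + ν * (D * D) - (V + 2ℚ * D * (ν * D′))) ≡⟨ cong (λ t → Y + (s₁ + ν * (D * D) - t)) expand ⟩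
      Y + (s₁ + ν * (D * D) - (s₁ + ν * (D * D))) ≡⟨ cong (Y +_) (ℚ.+-inverseʳ (s₁ + ν * (D * D))) ⟩
      Y + 0ℚ ≡⟨ ℚ.+-identityʳ Y ⟩
      Y ∎)
    where
    s₁ = norms a one 1
    V = ⟨ deviation , deviation ⟩
    Y = ((1ℚ + κ) * (D * D) * ν - s₁) + 2ℚ * (D * ν) * (D′ - (1ℚ - τ) * D)
    rearrange : ∀ κ τ d d′ ν s v → (κ + 2ℚ * τ) * (d * d) * ν - v
      ≡ ((1ℚ + κ) * (d * d) * ν - s) + 2ℚ * (d * ν) * (d′ - (1ℚ - τ) * d) + (s + ν * (d * d) - (v + 2ℚ * d * (ν * d′)))
    rearrange = solve-∀ ring
    entry : ∀ u d → (u - d) * (u - d) + 2ℚ * d * u ≡ u * u + d * d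
    entry = solve-∀ ring
    expand : V + 2ℚ * D * (ν * D′) ≡ s₁ + ν * (D * D)
    expand = begin-equality
      V + 2ℚ * D * (ν * D′)                      ≡⟨ cong (λ t → V + 2ℚ * D * t) total ⟨
      V + 2ℚ * D * sum (apply a one)             ≡⟨ cong (V +_) (*-distribˡ-sum (2ℚ * D) (apply a one)) ⟩
      V + sum (λ v → 2ℚ * D * apply a one v)     ≡⟨ ∑-distrib-+ (λ v → deviation v * deviation v) (λ v → 2ℚ * D * apply a one v) ⟨
      sum (λ v → deviation v * deviation v + 2ℚ * D * apply a one v)
                                                 ≡⟨ sum-cong-≗ (λ v → entry (apply a one v) D) ⟩
      sum (λ v → apply a one v * apply a one v + D * D)
                                                 ≡⟨ ∑-distrib-+ (λ v → apply a one v * apply a one v) (λ _ → D * D) ⟩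
      s₁ + sum {n} (λ _ → D * D)                 ≡⟨ cong (s₁ +_) (sum-const-ν (D * D)) ⟩
      s₁ + ν * (D * D)                           ∎

  inner-bound : ∀ x u {c} → (∀ i → ∣ x i ∣ ≤ 1ℚ) → ⟨ u , u ⟩ ≤ c * (D * D) * ν → c ≤ e * e →
    ∣ ⟨ x , u ⟩ ∣ ≤ e * (D * ν)
  inner-bound x u {c} ∣x∣≤1 u≤ c≤e² = ∣∣≤-from-² (0≤* 0≤e (0≤* 0≤D 0≤ν)) (begin
    ⟨ x , u ⟩ * ⟨ x , u ⟩              ≤⟨ cauchy-schwarz x u ⟩
    ⟨ x , x ⟩ * ⟨ u , u ⟩              ≤⟨ *-mono-≤ (0≤norm x) (0≤norm u) (norm≤ν x ∣x∣≤1) u≤ ⟩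
    ν * (c * (D * D) * ν)              ≤⟨ *-monoˡ 0≤ν (*-monoʳ 0≤ν (*-monoʳ (0≤² D) c≤e²)) ⟩
    ν * (e * e * (D * D) * ν)          ≡⟨ rearrange ν e D ⟩
    e * (D * ν) * (e * (D * ν))        ∎)
    where
    rearrange : ∀ ν e d → ν * (e * e * (d * d) * ν) ≡ e * (d * ν) * (e * (d * ν))
    rearrange = solve-∀ ring

  -- Each part of `y` costs `e D ν`: the constant part `c` through `norm-deviation`, the centred
  -- part through `norm-orthogonal`.
  mixing : 0ℚ ≤ τ → ∀ x y c → (∀ i → 0ℚ ≤ x i) → (∀ i → x i ≤ 1ℚ) → (∀ i → 0ℚ ≤ y i) → (∀ i → y i ≤ 1ℚ) →
    0ℚ ≤ c → c ≤ 1ℚ → ν * c ≡ sum y →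
    ∣ ⟨ x , apply a y ⟩ - c * (D * sum x) ∣ ≤ 2ℚ * (e * (D * ν))
  mixing 0≤τ x y c 0≤x x≤1 0≤y y≤1 0≤c c≤1 νc≡ = begin
    ∣ ⟨ x , apply a y ⟩ - c * (D * sum x) ∣              ≡⟨ cong ∣_∣ decompose ⟩
    ∣ c * ⟨ x , deviation ⟩ + ⟨ x , apply a z ⟩ ∣        ≤⟨ ℚ.∣p+q∣≤∣p∣+∣q∣ (c * ⟨ x , deviation ⟩) _ ⟩
    ∣ c * ⟨ x , deviation ⟩ ∣ + ∣ ⟨ x , apply a z ⟩ ∣    ≤⟨ ℚ.+-mono-≤ first second ⟩
    e * (D * ν) + e * (D * ν)                            ≡⟨ double (e * (D * ν)) ⟩
    2ℚ * (e * (D * ν))                                   ∎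
    where
    z : Fin n → ℚ
    z i = y i - c
    double : ∀ x → x + x ≡ 2ℚ * x
    double = solve-∀ ring
    ∣x∣≤1 : ∀ i → ∣ x i ∣ ≤ 1ℚ
    ∣x∣≤1 i = subst (_≤ 1ℚ) (≡-sym (ℚ.0≤p⇒∣p∣≡p (0≤x i))) (x≤1 i)
    ∣z∣≤1 : ∀ i → ∣ z i ∣ ≤ 1ℚ
    ∣z∣≤1 i = ∣∣≤ (≤-from-slack (0≤+ (≤⇒0≤- (y≤1 i)) 0≤c) (up (y i) c)) (≤-from-slack (0≤+ (≤⇒0≤- c≤1) (0≤y i)) (down (y i) c))
      where
      up : ∀ y c → 1ℚ - (y - c) ≡ 1ℚ - y + c
      up = solve-∀ ring
      down : ∀ y c → 1ℚ - (- (y - c)) ≡ 1ℚ - c + y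
      down = solve-∀ ring
    Σz≡0 : sum z ≡ 0ℚ
    Σz≡0 = begin-equality
      sum (λ i → y i + - c)             ≡⟨ ∑-distrib-+ y (λ _ → - c) ⟩
      sum y + sum {n} (λ _ → - c)       ≡⟨ cong₂ _+_ (≡-sym νc≡) (sum-const-ν (- c)) ⟩
      ν * c + ν * (- c)                 ≡⟨ cancel ν c ⟩
      0ℚ                                ∎
      where
      cancel : ∀ ν c → ν * c + ν * (- c) ≡ 0ℚ
      cancel = solve-∀ ring
    first : ∣ c * ⟨ x , deviation ⟩ ∣ ≤ e * (D * ν)
    first = begin
      ∣ c * ⟨ x , deviation ⟩ ∣       ≡⟨ ℚ.∣p*q∣≡∣p∣*∣q∣ c ⟨ x , deviation ⟩ ⟩
      ∣ c ∣ * ∣ ⟨ x , deviation ⟩ ∣   ≡⟨ cong (_* ∣ ⟨ x , deviation ⟩ ∣) (ℚ.0≤p⇒∣p∣≡p 0≤c) ⟩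
      c * ∣ ⟨ x , deviation ⟩ ∣       ≤⟨ *-monoʳ (ℚ.0≤∣p∣ ⟨ x , deviation ⟩) c≤1 ⟩
      1ℚ * ∣ ⟨ x , deviation ⟩ ∣      ≡⟨ ℚ.*-identityˡ ∣ ⟨ x , deviation ⟩ ∣ ⟩
      ∣ ⟨ x , deviation ⟩ ∣           ≤⟨ inner-bound x deviation ∣x∣≤1 norm-deviation e-large ⟩
      e * (D * ν)                     ∎
    second : ∣ ⟨ x , apply a z ⟩ ∣ ≤ e * (D * ν)
    second = inner-bound x (apply a z) ∣x∣≤1 (norm-orthogonal z ∣z∣≤1 Σz≡0)
      (ℚ.≤-trans (≤-from-slack (0≤* (ℚ.nonNegative⁻¹ 2ℚ) 0≤τ) (diff κ (2ℚ * τ))) e-large)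
      where
      diff : ∀ q r → q + r - q ≡ r
      diff = solve-∀ ring
    apply-split : ∀ v → apply a y v ≡ c * apply a one v + apply a z v
    apply-split v = begin-equality
      sum (λ w → a v w * y w)                                        ≡⟨ sum-cong-≗ (λ w → entry c (a v w) (y w)) ⟩
      sum (λ w → c * (a v w * 1ℚ) + a v w * z w)                     ≡⟨ ∑-distrib-+ (λ w → c * (a v w * 1ℚ)) (λ w → a v w * z w) ⟩
      sum (λ w → c * (a v w * 1ℚ)) + apply a z v                     ≡⟨ cong (_+ apply a z v) (*-distribˡ-sum c (λ w → a v w * 1ℚ)) ⟨
      c * apply a one v + apply a z v                                ∎
      where
      entry : ∀ c a y → a * y ≡ c * (a * 1ℚ) + a * (y - c)
      entry = solve-∀ ring
    entry : ∀ x c d t s → x * (c * t + s) ≡ c * (x * (t - d)) + x * s + c * (d * x)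
    entry = solve-∀ ring
    expand : ⟨ x , apply a y ⟩ ≡ c * ⟨ x , deviation ⟩ + ⟨ x , apply a z ⟩ + c * (D * sum x)
    expand = begin-equality
      sum (λ v → x v * apply a y v)
        ≡⟨ sum-cong-≗ (λ v → trans (cong (x v *_) (apply-split v)) (entry (x v) c D (apply a one v) (apply a z v))) ⟩
      sum (λ v → c * (x v * deviation v) + x v * apply a z v + c * (D * x v))
        ≡⟨ ∑-distrib-+ (λ v → c * (x v * deviation v) + x v * apply a z v) (λ v → c * (D * x v)) ⟩
      sum (λ v → c * (x v * deviation v) + x v * apply a z v) + sum (λ v → c * (D * x v))
        ≡⟨ cong₂ _+_ (∑-distrib-+ (λ v → c * (x v * deviation v)) (λ v → x v * apply a z v))
                     (trans (≡-sym (*-distribˡ-sum c (λ v → D * x v))) (cong (c *_) (≡-sym (*-distribˡ-sum D x)))) ⟩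
      sum (λ v → c * (x v * deviation v)) + ⟨ x , apply a z ⟩ + c * (D * sum x)
        ≡⟨ cong (λ t → t + ⟨ x , apply a z ⟩ + c * (D * sum x)) (*-distribˡ-sum c (λ v → x v * deviation v)) ⟨
      c * ⟨ x , deviation ⟩ + ⟨ x , apply a z ⟩ + c * (D * sum x) ∎
    cancel : ∀ p q → p + q - q ≡ p
    cancel = solve-∀ ring
    decompose : ⟨ x , apply a y ⟩ - c * (D * sum x) ≡ c * ⟨ x , deviation ⟩ + ⟨ x , apply a z ⟩
    decompose = trans (cong (_- c * (D * sum x)) expand) (cancel (c * ⟨ x , deviation ⟩ + ⟨ x , apply a z ⟩) (c * (D * sum x)))

-- Walks in graphs of bounded degree

indicator : (Fin n → Bool) → Fin n → ℚ
indicator A v = ℕ→ℚ (b2n (A v))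

matrix : Graph n → Fin n → Fin n → ℚ
matrix G v w = ℕ→ℚ (b2n (adj G v w))

0≤indicator : ∀ (A : Fin n → Bool) v → 0ℚ ≤ indicator A v
0≤indicator A v = 0≤fromℕ (b2n (A v))

indicator≤1 : ∀ (A : Fin n → Bool) v → indicator A v ≤ 1ℚ
indicator≤1 A v = fromℕ-mono (b2n≤1 (A v))

edges-inner : ∀ (G : Graph n) A B → ℕ→ℚ (edges G A B) ≡ ⟨ indicator A , apply (matrix G) (indicator B) ⟩
edges-inner {n} G A B = trans (fromℕ-Σv n _) (sum-cong-≗ λ v →
  trans (fromℕ-* (b2n (A v)) (degIn G B v)) (cong (indicator A v *_)
    (trans (fromℕ-Σv n _) (sum-cong-≗ λ w →
      trans (fromℕ-* (b2n (B w)) (b2n (adj G v w))) (ℚ.*-comm (indicator B w) (matrix G v w))))))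

nbSum : Graph n → ℕ → Fin n → (Fin n → ℚ) → Fin n → ℚ
nbSum G j u z v = sum (λ w → ℕ→ℚ (nb G j u v w) * z w)

nbSum-suc : ∀ (G : Graph n) j u z v → nbSum G (suc j) u z v ≡
  sum (λ x → ℕ→ℚ (b2n (adj G v x ∧ not ⌊ x Fin.≟ u ⌋)) * nbSum G j v z x)
nbSum-suc {n} G j u z v = begin
  sum (λ w → ℕ→ℚ (nb G (suc j) u v w) * z w)
    ≡⟨ sum-cong-≗ (λ w → trans (cong (_* z w) (fromℕ-Σv n _)) (*-distribʳ-sum (z w) (λ x → ℕ→ℚ (c x ℕ.* nb G j v x w)))) ⟩
  sum (λ w → sum (λ x → ℕ→ℚ (c x ℕ.* nb G j v x w) * z w))
    ≡⟨ ∑-comm (λ w x → ℕ→ℚ (c x ℕ.* nb G j v x w) * z w) ⟩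
  sum (λ x → sum (λ w → ℕ→ℚ (c x ℕ.* nb G j v x w) * z w))
    ≡⟨ (sum-cong-≗ λ x → sum-cong-≗ λ w → trans (cong (_* z w) (fromℕ-* (c x) (nb G j v x w))) (ℚ.*-assoc (ℕ→ℚ (c x)) (ℕ→ℚ (nb G j v x w)) (z w))) ⟩
  sum (λ x → sum (λ w → ℕ→ℚ (c x) * (ℕ→ℚ (nb G j v x w) * z w)))
    ≡⟨ sum-cong-≗ (λ x → *-distribˡ-sum (ℕ→ℚ (c x)) (λ w → ℕ→ℚ (nb G j v x w) * z w)) ⟨
  sum (λ x → ℕ→ℚ (c x) * nbSum G j v z x) ∎
  where
  open ≡-Reasoning
  c : Fin n → ℕ
  c x = b2n (adj G v x ∧ not ⌊ x Fin.≟ u ⌋)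

-- `a` says that the step is an edge, `b` that it returns to the previous vertex. Errors are
-- inherited from `p - m`, except that a returning step drops `m` and so leaves all of `p`, which is
-- at most `P`. The factor 1 matches `Σv-point`.
step-bound : ∀ (a b : Bool) p m {P} → 0ℚ ≤ P → ∣ p ∣ ≤ P →
  ∣ ℕ→ℚ (b2n a) * p - ℕ→ℚ (b2n (a ∧ not b)) * m ∣ ≤ ℕ→ℚ (b2n a) * ∣ p - m ∣ + ℕ→ℚ (b2n b ℕ.* 1) * P
step-bound false b p m {P} 0≤P p≤P = begin
  ∣ 0ℚ * p - 0ℚ * m ∣                              ≡⟨ cong ∣_∣ (vanish p m) ⟩
  0ℚ                                               ≤⟨ 0≤+ (ℚ.≤-reflexive (≡-sym (ℚ.*-zeroˡ ∣ p - m ∣))) (0≤* (0≤fromℕ (b2n b ℕ.* 1)) 0≤P) ⟩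
  0ℚ * ∣ p - m ∣ + ℕ→ℚ (b2n b ℕ.* 1) * P           ∎
  where
  open ℚ.≤-Reasoning
  vanish : ∀ s t → 0ℚ * s - 0ℚ * t ≡ 0ℚ
  vanish = solve-∀ ring
step-bound true true p m {P} 0≤P p≤P = begin
  ∣ 1ℚ * p - 0ℚ * m ∣              ≡⟨ cong ∣_∣ (drop p m) ⟩
  ∣ p ∣                            ≤⟨ p≤P ⟩
  P                                ≤⟨ ≤-from-slack (ℚ.0≤∣p∣ (p - m)) (rest ∣ p - m ∣ P) ⟩
  1ℚ * ∣ p - m ∣ + 1ℚ * P          ∎
  where
  open ℚ.≤-Reasoning
  drop : ∀ s t → 1ℚ * s - 0ℚ * t ≡ s
  drop = solve-∀ ring
  rest : ∀ s t → 1ℚ * s + 1ℚ * t - t ≡ s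
  rest = solve-∀ ring
step-bound true false p m {P} 0≤P p≤P = ℚ.≤-reflexive (trans (cong ∣_∣ (factor p m)) (≡-sym (trim ∣ p - m ∣ P)))
  where
  factor : ∀ s t → 1ℚ * s - 1ℚ * t ≡ s - t
  factor = solve-∀ ring
  trim : ∀ s t → 1ℚ * s + 0ℚ * t ≡ s
  trim = solve-∀ ring

module BoundedDegree (G : Graph n) (Δ : ℚ) (0≤Δ : 0ℚ ≤ Δ) (degree≤Δ : ∀ v → sum (matrix G v) ≤ Δ)
  (z : Fin n → ℚ) (∣z∣≤1 : ∀ i → ∣ z i ∣ ≤ 1ℚ) where

  open ℚ.≤-Reasoning

  ∣weighted∣≤ : ∀ v (f : Fin n → ℚ) {B} → 0ℚ ≤ B → (∀ x → ∣ f x ∣ ≤ B) →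
    sum (λ x → matrix G v x * ∣ f x ∣) ≤ Δ * B
  ∣weighted∣≤ v f {B} 0≤B f≤B = begin
    sum (λ x → matrix G v x * ∣ f x ∣)   ≤⟨ sum-mono (λ x → *-monoˡ (0≤fromℕ (b2n (adj G v x))) (f≤B x)) ⟩
    sum (λ x → matrix G v x * B)         ≡⟨ *-distribʳ-sum B (matrix G v) ⟨
    sum (matrix G v) * B                 ≤⟨ *-monoʳ 0≤B (degree≤Δ v) ⟩
    Δ * B                                ∎

  ∣power∣≤ : ∀ j v → ∣ power (matrix G) j z v ∣ ≤ Δ ^ℚ j
  ∣power∣≤ zero    v = ∣z∣≤1 v
  ∣power∣≤ (suc j) v = begin
    ∣ sum (λ x → matrix G v x * p x) ∣      ≤⟨ ∣sum∣≤ (λ x → matrix G v x * p x) ⟩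
    sum (λ x → ∣ matrix G v x * p x ∣)      ≡⟨ sum-cong-≗ (λ x → trans (ℚ.∣p*q∣≡∣p∣*∣q∣ (matrix G v x) (p x)) (cong (_* ∣ p x ∣) (ℚ.0≤p⇒∣p∣≡p (0≤fromℕ (b2n (adj G v x)))))) ⟩
    sum (λ x → matrix G v x * ∣ p x ∣)      ≤⟨ ∣weighted∣≤ v p (^-nonneg j 0≤Δ) (∣power∣≤ j) ⟩
    Δ * Δ ^ℚ j                              ∎
    where p = power (matrix G) j z

  power≈nb₀ : ∀ u v → ∣ power (matrix G) 0 z v - nbSum G 0 u z v ∣ ≤ 0ℚ
  power≈nb₀ u v = ℚ.≤-reflexive (cong ∣_∣ (trans (cong (λ t → z v - t) sum≡) (ℚ.+-inverseʳ (z v))))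
    where
    point : ∀ {n} (v : Fin n) (z : Fin n → ℚ) → sum (λ w → ℕ→ℚ (b2n ⌊ v Fin.≟ w ⌋) * z w) ≡ z v
    point {suc n} zero z = trans (cong₂ _+_ (ℚ.*-identityˡ (z zero))
      (trans (sum-cong-≗ λ w → ℚ.*-zeroˡ (z (suc w))) (sum-0 n))) (ℚ.+-identityʳ (z zero))
    point {suc n} (suc v) z = trans (cong₂ _+_ (ℚ.*-zeroˡ (z zero)) (trans (sum-cong-≗ shift′) (point v (z ∘ suc)))) (ℚ.+-identityˡ (z (suc v)))
      where
      shift′ : ∀ w → ℕ→ℚ (b2n ⌊ suc v Fin.≟ suc w ⌋) * z (suc w) ≡ ℕ→ℚ (b2n ⌊ v Fin.≟ w ⌋) * z (suc w)
      shift′ w with v Fin.≟ w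
      ... | yes _ = refl
      ... | no  _ = refl
    sum≡ : nbSum G 0 u z v ≡ z v
    sum≡ = point v z

  -- A walk that backtracks at its first step contributes at most Δ ^ j; the others recurse.
  power≈nb-suc : ∀ j {B} → 0ℚ ≤ B → (∀ u v → ∣ power (matrix G) j z v - nbSum G j u z v ∣ ≤ B) →
    ∀ u v → ∣ power (matrix G) (suc j) z v - nbSum G (suc j) u z v ∣ ≤ Δ * B + Δ ^ℚ j
  power≈nb-suc j {B} 0≤B approx u v = begin
    ∣ power (matrix G) (suc j) z v - nbSum G (suc j) u z v ∣
      ≡⟨ cong ∣_∣ difference ⟩
    ∣ sum (λ x → matrix G v x * p x - c x * m x) ∣
      ≤⟨ ∣sum∣≤ (λ x → matrix G v x * p x - c x * m x) ⟩
    sum (λ x → ∣ matrix G v x * p x - c x * m x ∣)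
      ≤⟨ sum-mono entry ⟩
    sum (λ x → matrix G v x * ∣ p x - m x ∣ + i x * Δ ^ℚ j)
      ≡⟨ ∑-distrib-+ (λ x → matrix G v x * ∣ p x - m x ∣) (λ x → i x * Δ ^ℚ j) ⟩
    sum (λ x → matrix G v x * ∣ p x - m x ∣) + sum (λ x → i x * Δ ^ℚ j)
      ≤⟨ ℚ.+-mono-≤ (∣weighted∣≤ v (λ x → p x - m x) 0≤B (λ x → approx v x)) (ℚ.≤-reflexive single) ⟩
    Δ * B + Δ ^ℚ j ∎
    where
    p m c i : Fin n → ℚ
    p = power (matrix G) j z
    m = nbSum G j v z
    c x = ℕ→ℚ (b2n (adj G v x ∧ not ⌊ x Fin.≟ u ⌋))
    i x = ℕ→ℚ (b2n ⌊ x Fin.≟ u ⌋ ℕ.* 1)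
    neg : ∀ s → - s ≡ (- 1ℚ) * s
    neg = solve-∀ ring
    difference : power (matrix G) (suc j) z v - nbSum G (suc j) u z v ≡ sum (λ x → matrix G v x * p x - c x * m x)
    difference = begin-equality
      sum (λ x → matrix G v x * p x) - nbSum G (suc j) u z v
        ≡⟨ cong (λ t → sum (λ x → matrix G v x * p x) - t) (nbSum-suc G j u z v) ⟩
      sum (λ x → matrix G v x * p x) - sum (λ x → c x * m x)
        ≡⟨ cong (sum (λ x → matrix G v x * p x) +_) (trans (neg (sum (λ x → c x * m x)))
             (trans (*-distribˡ-sum (- 1ℚ) (λ x → c x * m x)) (sum-cong-≗ λ x → ≡-sym (neg (c x * m x))))) ⟩
      sum (λ x → matrix G v x * p x) + sum (λ x → - (c x * m x))
        ≡⟨ ∑-distrib-+ (λ x → matrix G v x * p x) (λ x → - (c x * m x)) ⟨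
      sum (λ x → matrix G v x * p x - c x * m x) ∎
    entry : ∀ x → ∣ matrix G v x * p x - c x * m x ∣ ≤ matrix G v x * ∣ p x - m x ∣ + i x * Δ ^ℚ j
    entry x = step-bound (adj G v x) ⌊ x Fin.≟ u ⌋ (p x) (m x) (^-nonneg j 0≤Δ) (∣power∣≤ j x)
    single : sum (λ x → i x * Δ ^ℚ j) ≡ Δ ^ℚ j
    single = begin-equality
      sum (λ x → i x * Δ ^ℚ j)     ≡⟨ *-distribʳ-sum (Δ ^ℚ j) i ⟨
      sum i * Δ ^ℚ j               ≡⟨ cong (_* Δ ^ℚ j) (trans (≡-sym (fromℕ-Σv n _)) (cong ℕ→ℚ (Σv-point n u (λ _ → 1)))) ⟩
      1ℚ * Δ ^ℚ j                  ≡⟨ ℚ.*-identityˡ (Δ ^ℚ j) ⟩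
      Δ ^ℚ j                       ∎

  -- Started from 0, the recursion `B ↦ Δ B + Δ^j` of `power≈nb-suc` solves to `(j+1) Δ^j` after
  -- `j+1` steps. At length `k` this is of order `d^(k-1)`, a factor `d` below `n`.
  power≈nb : ∀ j u v → ∣ power (matrix G) (suc j) z v - nbSum G (suc j) u z v ∣ ≤ ℕ→ℚ (suc j) * Δ ^ℚ j
  power≈nb zero u v = ℚ.≤-trans (power≈nb-suc 0 ℚ.≤-refl power≈nb₀ u v) (ℚ.≤-reflexive (base Δ))
    where
    base : ∀ Δ → Δ * 0ℚ + 1ℚ ≡ 1ℚ * 1ℚ
    base = solve-∀ ring
  power≈nb (suc j) u v = ℚ.≤-trans
    (power≈nb-suc (suc j) (0≤* (0≤fromℕ (suc j)) (^-nonneg j 0≤Δ)) (power≈nb j) u v)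
    (ℚ.≤-reflexive (trans (collect Δ (ℕ→ℚ (suc j)) (Δ ^ℚ j)) (cong (_* (Δ * Δ ^ℚ j)) (≡-sym (fromℕ-suc (suc j))))))
    where
    collect : ∀ Δ c p → Δ * (c * p) + Δ * p ≡ (1ℚ + c) * (Δ * p)
    collect = solve-∀ ring

-- Deleting the edges at vertices of high degree

everything : Fin n → Bool
everything _ = true

-- The flagged vertices become isolated but stay, so that `n` and the index set of all vectors do
-- not change.
truncate : Graph n → (Fin n → Bool) → Graph n
truncate G h .adj u v = adj G u v ∧ not (h u) ∧ not (h v)
truncate G h .sym u v = cong₂ _∧_ (sym G u v) (Bool.∧-comm (not (h u)) (not (h v)))
truncate G h .irrefl v = cong (_∧ (not (h v) ∧ not (h v))) (irrefl G v)

truncate-free : ∀ {k} {G : Graph n} h → CycleFree k G → CycleFree k (truncate G h)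
truncate-free {G = G} h (short , even) = (λ ℓ a b → short ℓ a b ∘ lift ℓ) , (λ j a b → even j a b ∘ lift (2 ℕ.* j))
  where
  ∧-true : ∀ a {b} → a ∧ b ≡ true → a ≡ true
  ∧-true true _ = refl
  lift : ∀ ℓ → HasCycle (truncate G h) ℓ → HasCycle G ℓ
  lift (suc m) (f , inj , edge , last) = f , inj , (λ i → ∧-true (adj G _ _) (edge i)) , ∧-true (adj G _ _) last

edges-flat : ∀ (G : Graph n) A B → edges G A B ≡ Σv n (λ u → Σv n (λ v → b2n (A u) ℕ.* (b2n (B v) ℕ.* b2n (adj G u v))))
edges-flat {n} G A B = Σv-cong n (λ u → ≡-sym (Σv-*ˡ n (b2n (A u)) (λ v → b2n (B v) ℕ.* b2n (adj G u v))))

edges-truncate≤ : ∀ (G : Graph n) h A B → edges (truncate G h) A B ℕ.≤ edges G A B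
edges-truncate≤ {n} G h A B = Σv-mono n λ u → ℕ.*-monoʳ-≤ (b2n (A u)) (Σv-mono n λ v → ℕ.*-monoʳ-≤ (b2n (B v)) (∧-≤ (adj G u v)))
  where
  ∧-≤ : ∀ a {b} → b2n (a ∧ b) ℕ.≤ b2n a
  ∧-≤ true  {b} = b2n≤1 b
  ∧-≤ false     = z≤n

-- A lost pair has its first or its second end in `h`. By symmetry both kinds are bounded by the
-- same count, whence the factor 2.
edges≤truncate : ∀ (G : Graph n) h A B →
  edges G A B ℕ.≤ edges (truncate G h) A B ℕ.+ 2 ℕ.* edges G h everything
edges≤truncate {n} G h A B = begin
  edges G A B
    ≡⟨ edges-flat G A B ⟩
  Σv n (λ u → Σv n (λ v → e A B u v))
    ≤⟨ (Σv-mono n λ u → Σv-mono n λ v → pointwise u v) ⟩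
  Σv n (λ u → Σv n (λ v → e′ u v ℕ.+ (e h everything u v ℕ.+ e everything h u v)))
    ≡⟨ split e′ (λ u v → e h everything u v ℕ.+ e everything h u v) ⟩
  Σv n (λ u → Σv n (e′ u)) ℕ.+ Σv n (λ u → Σv n (λ v → e h everything u v ℕ.+ e everything h u v))
    ≡⟨ cong₂ ℕ._+_ (≡-sym (edges-flat (truncate G h) A B)) (split (e h everything) (e everything h)) ⟩
  edges (truncate G h) A B ℕ.+ (Σv n (λ u → Σv n (e h everything u)) ℕ.+ Σv n (λ u → Σv n (e everything h u)))
    ≡⟨ cong (edges (truncate G h) A B ℕ.+_) (cong₂ ℕ._+_ (≡-sym (edges-flat G h everything))
         (trans (≡-sym (edges-flat G everything h)) (trans (edges-sym G everything h) (≡-sym (ℕ.+-identityʳ _))))) ⟩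
  edges (truncate G h) A B ℕ.+ 2 ℕ.* edges G h everything ∎
  where
  open ℕ.≤-Reasoning
  e : (Fin n → Bool) → (Fin n → Bool) → Fin n → Fin n → ℕ
  e A B u v = b2n (A u) ℕ.* (b2n (B v) ℕ.* b2n (adj G u v))
  e′ : Fin n → Fin n → ℕ
  e′ u v = b2n (A u) ℕ.* (b2n (B v) ℕ.* b2n (adj (truncate G h) u v))
  split : ∀ (f g : Fin n → Fin n → ℕ) → Σv n (λ u → Σv n (λ v → f u v ℕ.+ g u v)) ≡ Σv n (λ u → Σv n (f u)) ℕ.+ Σv n (λ u → Σv n (g u))
  split f g = trans (Σv-cong n λ u → Σv-+ n (f u) (g u)) (Σv-+ n _ _)
  pointwise : ∀ u v → e A B u v ℕ.≤ e′ u v ℕ.+ (e h everything u v ℕ.+ e everything h u v)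
  pointwise u v with A u | B v | adj G u v | h u | h v
  ... | false | _     | _     | _     | _     = z≤n
  ... | true  | false | _     | _     | _     = z≤n
  ... | true  | true  | false | _     | _     = z≤n
  ... | true  | true  | true  | true  | _     = s≤s z≤n
  ... | true  | true  | true  | false | true  = s≤s z≤n
  ... | true  | true  | true  | false | false = s≤s z≤n

alternating≥^ : ∀ {p q r} → r ℕ.≤ p → r ℕ.≤ q → ∀ j → r ℕ.^ j ℕ.≤ alternating p q j
alternating≥^ r≤p r≤q zero    = ℕ.≤-refl
alternating≥^ r≤p r≤q (suc j) = ℕ.*-mono-≤ r≤p (alternating≥^ r≤q r≤p j)

-- Only the leading factor `K q` is used in full; every later factor is bounded below by `q`.
alternating-large : ∀ K q j → 0 ℕ.< K → K ℕ.* q ℕ.^ suc j ℕ.≤ alternating (K ℕ.* q) q (suc j)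
alternating-large K@(suc _) q j _ = begin
  K ℕ.* (q ℕ.* q ℕ.^ j)                   ≡⟨ ℕ.*-assoc K q (q ℕ.^ j) ⟨
  K ℕ.* q ℕ.* q ℕ.^ j                     ≤⟨ ℕ.*-monoʳ-≤ (K ℕ.* q) (alternating≥^ ℕ.≤-refl (ℕ.m≤n*m q K) j) ⟩
  K ℕ.* q ℕ.* alternating q (K ℕ.* q) j   ∎
  where open ℕ.≤-Reasoning

flag-bound : ∀ x {y} → 0ℚ ≤ y → ℕ→ℚ (b2n ⌊ x ℚ.≤? y ⌋) * x ≤ y
flag-bound x {y} 0≤y with x ℚ.≤? y
... | yes x≤y = subst (_≤ y) (≡-sym (ℚ.*-identityˡ x)) x≤y
... | no  _   = subst (_≤ y) (≡-sym (ℚ.*-zeroˡ x)) 0≤y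

unflagged : ∀ x y → ⌊ x ℚ.≤? y ⌋ ≡ false → y ≤ x
unflagged x y eq with x ℚ.≤? y
... | no x≰y = ℚ.<⇒≤ (ℚ.≰⇒> x≰y)

degree-truncate≤ : ∀ (G : Graph n) h v → Σv n (λ w → b2n (adj (truncate G h) v w)) ℕ.≤ degIn G everything v
degree-truncate≤ {n} G h v = Σv-mono n λ w → pointwise (adj G v w) (not (h v) ∧ not (h w))
  where
  pointwise : ∀ a b → b2n (a ∧ b) ℕ.≤ 1 ℕ.* b2n a
  pointwise true  b = b2n≤1 b
  pointwise false b = z≤n

degree-truncate≡0 : ∀ (G : Graph n) h v → h v ≡ true → Σv n (λ w → b2n (adj (truncate G h) v w)) ≡ 0
degree-truncate≡0 {n} G h v hv = Σv-zero n λ w → isolated w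
  where
  isolated : ∀ w → b2n (adj (truncate G h) v w) ≡ 0
  isolated w rewrite hv = cong b2n (Bool.∧-zeroʳ (adj G v w))

module Truncation {n} (G : Graph n) (k′ : ℕ) (free : CycleFree (suc k′) G)
  (ν inv d : ℚ) (ν≡n : ν ≡ ℕ→ℚ n) (0<ν : 0ℚ < ν) (inv*ν : inv * ν ≡ 1ℚ) (0≤inv : 0ℚ ≤ inv) (0≤d : 0ℚ ≤ d)
  (total : ℕ→ℚ (edges G everything everything) ≡ ν * d)
  (K q : ℕ) (0<K : 0 ℕ.< K) (n<Kq^k : n ℕ.< K ℕ.* q ℕ.^ suc k′)
  (θ τ β κ ρ e : ℚ) (0≤θ : 0ℚ ≤ θ) (0≤κ : 0ℚ ≤ κ) (0≤e : 0ℚ ≤ e) (0≤β : 0ℚ ≤ β) (β≤1 : β ≤ 1ℚ)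
  (q≤θd : ℕ→ℚ q ≤ θ * d)
  (backtracking-small : ℕ→ℚ (suc k′) * (ℕ→ℚ K * d) ^ℚ k′ ≤ β * ν)
  (τ≡4θ : τ ≡ 2ℚ * (2ℚ * θ)) (τ≤1 : τ ≤ 1ℚ)
  (d-power : (1ℚ - ρ) * (ν * ν) ≤ ((1ℚ - τ) * d * ((1ℚ - τ) * d)) ^ℚ suc k′)
  (κ-power : (ρ + (3ℚ * β + 3ℚ * β)) * (ν * ν) ≤ (κ * (d * d)) ^ℚ suc k′)
  (1+κ-power : (1ℚ + 3ℚ * β) * (ν * ν) ≤ ((1ℚ + κ) * (d * d)) ^ℚ suc k′)
  (e-large : κ + 2ℚ * τ ≤ e * e)
  where

  open ℚ.≤-Reasoning

  Δ : ℚ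
  Δ = ℕ→ℚ K * d

  0≤Δ : 0ℚ ≤ Δ
  0≤Δ = 0≤* (0≤fromℕ K) 0≤d

  0≤ν : 0ℚ ≤ ν
  0≤ν = ℚ.<⇒≤ 0<ν

  high : Fin n → Bool
  high v = ⌊ Δ ℚ.≤? ℕ→ℚ (degIn G everything v) ⌋

  G′ : Graph n
  G′ = truncate G high

  lost : ℕ
  lost = edges G high everything

  -- Markov's inequality for the degrees. As `Δ = K d`, a fraction of at most `1 / K` of the
  -- vertices is flagged.
  size-high : ℕ→ℚ (size high) * Δ ≤ ν * d
  size-high = begin
    ℕ→ℚ (size high) * Δ                                  ≡⟨ cong (_* Δ) (fromℕ-Σv n (λ v → b2n (high v))) ⟩
    sum (indicator high) * Δ                             ≡⟨ *-distribʳ-sum Δ (indicator high) ⟩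
    sum (λ v → indicator high v * Δ)                     ≤⟨ sum-mono (λ v → flag-bound Δ (0≤fromℕ (degIn G everything v))) ⟩
    sum (λ v → ℕ→ℚ (degIn G everything v))               ≡⟨ fromℕ-Σv n (degIn G everything) ⟨
    ℕ→ℚ (Σv n (degIn G everything))                      ≡⟨ cong ℕ→ℚ (Σv-cong n λ v → ≡-sym (ℕ.+-identityʳ (degIn G everything v))) ⟩
    ℕ→ℚ (edges G everything everything)                  ≡⟨ total ⟩
    ν * d                                                ∎

  -- The two terms of `edges-bound` balance: the coefficient `K q` meets the few vertices of `high`,
  -- the coefficient `q` meets all vertices, and each product is at most `θ ν d`.
  lost≤ : ℕ→ℚ lost ≤ 2ℚ * (θ * (ν * d))
  lost≤ = begin
    ℕ→ℚ lost
      ≤⟨ fromℕ-mono (edges-bound free {K ℕ.* q} {q} (ℕ.<-≤-trans n<Kq^k (alternating-large K q k′ 0<K)) high everything) ⟩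
    ℕ→ℚ (K ℕ.* q ℕ.* size high ℕ.+ q ℕ.* size (everything {n}))
      ≤⟨ fromℕ-mono (ℕ.+-monoʳ-≤ (K ℕ.* q ℕ.* size high) (ℕ.*-monoʳ-≤ q (Σv-≤n n (λ _ → ℕ.≤-refl)))) ⟩
    ℕ→ℚ (K ℕ.* q ℕ.* size high ℕ.+ q ℕ.* n)
      ≡⟨ trans (fromℕ-+ (K ℕ.* q ℕ.* size high) (q ℕ.* n)) (cong₂ _+_
           (trans (fromℕ-* (K ℕ.* q) (size high)) (cong (_* ℕ→ℚ (size high)) (fromℕ-* K q)))
           (trans (fromℕ-* q n) (cong (ℕ→ℚ q *_) (≡-sym ν≡n)))) ⟩
    ℕ→ℚ K * ℕ→ℚ q * ℕ→ℚ (size high) + ℕ→ℚ q * ν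
      ≤⟨ ℚ.+-mono-≤ (*-monoʳ (0≤fromℕ (size high)) (*-monoˡ (0≤fromℕ K) q≤θd)) (*-monoʳ 0≤ν q≤θd) ⟩
    ℕ→ℚ K * (θ * d) * ℕ→ℚ (size high) + θ * d * ν
      ≡⟨ rearrange (ℕ→ℚ K) θ d (ℕ→ℚ (size high)) ν ⟩
    θ * (ℕ→ℚ (size high) * Δ) + θ * (ν * d)
      ≤⟨ ℚ.+-monoˡ-≤ (θ * (ν * d)) (*-monoˡ 0≤θ size-high) ⟩
    θ * (ν * d) + θ * (ν * d)
      ≡⟨ double (θ * (ν * d)) ⟩
    2ℚ * (θ * (ν * d)) ∎
    where
    rearrange : ∀ K θ d s ν → K * (θ * d) * s + θ * d * ν ≡ θ * (s * (K * d)) + θ * (ν * d)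
    rearrange = solve-∀ ring
    double : ∀ x → x + x ≡ 2ℚ * x
    double = solve-∀ ring

  -- This is where `τ = 4 θ` comes from: one factor 2 from `lost≤`, the other from `edges≤truncate`.
  edges-G≤ : ∀ A B → ℕ→ℚ (edges G A B) ≤ ℕ→ℚ (edges G′ A B) + τ * (ν * d)
  edges-G≤ A B = begin
    ℕ→ℚ (edges G A B)                               ≤⟨ fromℕ-mono (edges≤truncate G high A B) ⟩
    ℕ→ℚ (edges G′ A B ℕ.+ 2 ℕ.* lost)               ≡⟨ trans (fromℕ-+ (edges G′ A B) (2 ℕ.* lost)) (cong (ℕ→ℚ (edges G′ A B) +_) (fromℕ-* 2 lost)) ⟩
    ℕ→ℚ (edges G′ A B) + 2ℚ * ℕ→ℚ lost              ≤⟨ ℚ.+-monoʳ-≤ (ℕ→ℚ (edges G′ A B)) (*-monoˡ (ℚ.nonNegative⁻¹ 2ℚ) lost≤) ⟩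
    ℕ→ℚ (edges G′ A B) + 2ℚ * (2ℚ * (θ * (ν * d)))  ≡⟨ cong (ℕ→ℚ (edges G′ A B) +_) (trans (assoc θ (ν * d)) (cong (_* (ν * d)) (≡-sym τ≡4θ))) ⟩
    ℕ→ℚ (edges G′ A B) + τ * (ν * d)                ∎
    where
    assoc : ∀ θ x → 2ℚ * (2ℚ * (θ * x)) ≡ 2ℚ * (2ℚ * θ) * x
    assoc = solve-∀ ring

  degree-G′ : ∀ v → sum (matrix G′ v) ≤ Δ
  degree-G′ v = split (high v) refl
    where
    split : ∀ b → high v ≡ b → sum (matrix G′ v) ≤ Δ
    split true  eq = begin
      sum (matrix G′ v)                        ≡⟨ fromℕ-Σv n (λ w → b2n (adj G′ v w)) ⟨
      ℕ→ℚ (Σv n (λ w → b2n (adj G′ v w)))      ≡⟨ cong ℕ→ℚ (degree-truncate≡0 G high v eq) ⟩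
      0ℚ                                       ≤⟨ 0≤Δ ⟩
      Δ                                        ∎
    split false eq = begin
      sum (matrix G′ v)                        ≡⟨ fromℕ-Σv n (λ w → b2n (adj G′ v w)) ⟨
      ℕ→ℚ (Σv n (λ w → b2n (adj G′ v w)))      ≤⟨ fromℕ-mono (degree-truncate≤ G high v) ⟩
      ℕ→ℚ (degIn G everything v)               ≤⟨ unflagged Δ (ℕ→ℚ (degIn G everything v)) eq ⟩
      Δ                                        ∎

  total′ D′ : ℚ
  total′ = sum (apply (matrix G′) one)
  D′ = inv * total′

  total′≡ : total′ ≡ ℕ→ℚ (edges G′ everything everything)
  total′≡ = ≡-sym (trans (edges-inner G′ everything everything) (sum-cong-≗ λ v → ℚ.*-identityˡ (apply (matrix G′) one v)))

  ν*inv* : ∀ x → ν * (inv * x) ≡ x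
  ν*inv* x = begin-equality
    ν * (inv * x)   ≡⟨ rearrange ν inv x ⟩
    inv * ν * x     ≡⟨ cong (_* x) inv*ν ⟩
    1ℚ * x          ≡⟨ ℚ.*-identityˡ x ⟩
    x               ∎
    where
    rearrange : ∀ ν i x → ν * (i * x) ≡ i * ν * x
    rearrange = solve-∀ ring

  D′-large : (1ℚ - τ) * d ≤ D′
  D′-large = *-cancelʳ 0<ν (begin
    (1ℚ - τ) * d * ν            ≤⟨ ≤-from-slack (≤⇒0≤- main) (rearrange τ d ν total′) ⟩
    total′                      ≡⟨ trans (≡-sym (ν*inv* total′)) (ℚ.*-comm ν D′) ⟩
    D′ * ν                      ∎)
    where
    rearrange : ∀ τ d ν t → t - (1ℚ - τ) * d * ν ≡ t + τ * (ν * d) - ν * d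
    rearrange = solve-∀ ring
    main : ν * d ≤ total′ + τ * (ν * d)
    main = subst₂ (λ s t → s ≤ t + τ * (ν * d)) total (≡-sym total′≡) (edges-G≤ everything everything)

  0≤τ : 0ℚ ≤ τ
  0≤τ = subst (0ℚ ≤_) (≡-sym τ≡4θ) (0≤* (ℚ.nonNegative⁻¹ 2ℚ) (0≤* (ℚ.nonNegative⁻¹ 2ℚ) 0≤θ))

  D′-power : (1ℚ - ρ) * (ν * ν) ≤ (D′ * D′) ^ℚ suc k′
  D′-power = ℚ.≤-trans d-power (^-mono (suc k′) (0≤* 0≤x 0≤x) (*-mono-≤ 0≤x 0≤x D′-large D′-large))
    where
    0≤x : 0ℚ ≤ (1ℚ - τ) * d
    0≤x = 0≤* (≤⇒0≤- τ≤1) 0≤d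

  M : Fin n → Fin n → ℚ
  M v w = ℕ→ℚ (nb G′ (suc k′) v v w)

  M≤1 : ∀ v w → M v w ≤ 1ℚ
  M≤1 v w = fromℕ-mono (nb≤1 (truncate-free high free) (suc k′) ℕ.≤-refl v v w)

  power≈M : ∀ z → (∀ i → ∣ z i ∣ ≤ 1ℚ) → ∀ v → ∣ power (matrix G′) (suc k′) z v - apply M z v ∣ ≤ β * ν
  power≈M z ∣z∣≤1 v = ℚ.≤-trans (BoundedDegree.power≈nb G′ Δ 0≤Δ degree-G′ z ∣z∣≤1 k′ v v) backtracking-small

  matrix-sym : ∀ v w → matrix G′ v w ≡ matrix G′ w v
  matrix-sym v w = cong (ℕ→ℚ ∘ b2n) (sym G′ v w)

  0≤M : ∀ v w → 0ℚ ≤ M v w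
  0≤M v w = 0≤fromℕ (nb G′ (suc k′) v v w)

  total′≡νD′ : total′ ≡ ν * D′
  total′≡νD′ = ≡-sym (ν*inv* total′)

  open Mixing (matrix G′) M matrix-sym k′ ν d D′ β κ τ ρ e
    ν≡n 0<ν 0≤d 0≤κ 0≤e 0≤β β≤1 0≤M M≤1 power≈M
    total′≡νD′ D′-large D′-power κ-power 1+κ-power e-large
    using (mixing)

  edge-discrepancy : ∀ A B → ∣ ℕ→ℚ (edges G A B) - inv * ℕ→ℚ (size B) * (d * ℕ→ℚ (size A)) ∣
    ≤ τ * (ν * d) + 2ℚ * (e * (d * ν))
  edge-discrepancy A B = begin
    ∣ eG₀ - main ∣                               ≡⟨ cong ∣_∣ (split eG₀ eG′ main) ⟩
    ∣ (eG₀ - eG′) + (eG′ - main) ∣               ≤⟨ ℚ.∣p+q∣≤∣p∣+∣q∣ (eG₀ - eG′) (eG′ - main) ⟩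
    ∣ eG₀ - eG′ ∣ + ∣ eG′ - main ∣               ≤⟨ ℚ.+-mono-≤ truncation-error mixing-error ⟩
    τ * (ν * d) + 2ℚ * (e * (d * ν))             ∎
    where
    eG₀ eG′ main : ℚ
    eG₀ = ℕ→ℚ (edges G A B)
    eG′ = ℕ→ℚ (edges G′ A B)
    main = inv * ℕ→ℚ (size B) * (d * ℕ→ℚ (size A))
    split : ∀ x y z → x - z ≡ (x - y) + (y - z)
    split = solve-∀ ring
    truncation-error : ∣ eG₀ - eG′ ∣ ≤ τ * (ν * d)
    truncation-error = subst (_≤ τ * (ν * d)) (≡-sym (ℚ.0≤p⇒∣p∣≡p (≤⇒0≤- (fromℕ-mono (edges-truncate≤ G high A B)))))
      (≤-from-slack (≤⇒0≤- (edges-G≤ A B)) (rearrange eG₀ eG′ (τ * (ν * d))))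
      where
      rearrange : ∀ x y t → t - (x - y) ≡ y + t - x
      rearrange = solve-∀ ring
    sum-indicator : ∀ C → sum (indicator C) ≡ ℕ→ℚ (size C)
    sum-indicator C = ≡-sym (fromℕ-Σv n (λ v → b2n (C v)))
    c = inv * ℕ→ℚ (size B)
    c≤1 : c ≤ 1ℚ
    c≤1 = begin
      inv * ℕ→ℚ (size B)  ≤⟨ *-monoˡ 0≤inv (fromℕ-mono (Σv-≤n n (λ v → b2n≤1 (B v)))) ⟩
      inv * ℕ→ℚ n         ≡⟨ cong (inv *_) ν≡n ⟨
      inv * ν             ≡⟨ inv*ν ⟩
      1ℚ                  ∎
    mixing-error : ∣ eG′ - main ∣ ≤ 2ℚ * (e * (d * ν))
    mixing-error = subst₂ (λ s t → ∣ s - c * (d * t) ∣ ≤ 2ℚ * (e * (d * ν)))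
      (≡-sym (edges-inner G′ A B)) (sum-indicator A)
      (mixing 0≤τ (indicator A) (indicator B) c (0≤indicator A) (indicator≤1 A) (0≤indicator B) (indicator≤1 B)
        (0≤* 0≤inv (0≤fromℕ (size B))) c≤1 (trans (ν*inv* (ℕ→ℚ (size B))) (≡-sym (sum-indicator B))))

-- Choice of parameters

1/suc : ℕ → ℚ
1/suc m = ℤ.+ 1 ℚ./ suc m

1/suc-* : ∀ m → 1/suc m * ℕ→ℚ (suc m) ≡ 1ℚ
1/suc-* m = begin
  1/suc m * ℕ→ℚ (suc m)       ≡⟨ cong₂ _*_ (ℚ.normalize-coprime (1-coprimeTo (suc m))) (fromℕ-mkℚ (suc m)) ⟩
  p * ℚ.1/ p                  ≡⟨ ℚ.*-inverseʳ p ⟩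
  1ℚ                          ∎
  where
  open ≡-Reasoning
  p = ℚ.mkℚ (ℤ.+ 1) m (1-coprimeTo (suc m))

suc-*-1/suc : ∀ m x → ℕ→ℚ (suc m) * (1/suc m * x) ≡ x
suc-*-1/suc m x = begin
  ℕ→ℚ (suc m) * (1/suc m * x)  ≡⟨ ℚ.*-assoc (ℕ→ℚ (suc m)) (1/suc m) x ⟨
  ℕ→ℚ (suc m) * 1/suc m * x    ≡⟨ cong (_* x) (trans (ℚ.*-comm (ℕ→ℚ (suc m)) (1/suc m)) (1/suc-* m)) ⟩
  1ℚ * x                       ≡⟨ ℚ.*-identityˡ x ⟩
  x                            ∎
  where open ≡-Reasoning

0<1/suc : ∀ m → 0ℚ < 1/suc m
0<1/suc m = ℚ.positive⁻¹ (1/suc m) {{ℚ.normalize-pos 1 (suc m)}}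

multiple≥ : ∀ {g} → 0ℚ < g → ∀ x → ∃ λ m → x ≤ ℕ→ℚ m * g
multiple≥ {g} 0<g x = m , (begin
  x                    ≡⟨ ℚ.*-identityʳ x ⟨
  x * 1ℚ               ≡⟨ cong (x *_) (ℚ.*-inverseˡ g) ⟨
  x * (ℚ.1/ g * g)     ≡⟨ ℚ.*-assoc x (ℚ.1/ g) g ⟨
  x * ℚ.1/ g * g       ≤⟨ *-monoʳ (ℚ.<⇒≤ 0<g) x/g≤m ⟩
  ℕ→ℚ m * g            ∎)
  where
  open ℚ.≤-Reasoning
  instance
    g≢0 : ℚ.NonZero g
    g≢0 = ℚ.pos⇒nonZero g {{ℚ.positive 0<g}}
  m = proj₁ (archimedean (x * ℚ.1/ g))
  x/g≤m = proj₂ (archimedean (x * ℚ.1/ g))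

-- The strongest demand on this constant is `κ-power`: there `ρ + 6 Ω` is `16 Ω`, and two uses of
-- `½ ν ≤ d^k` cost a further factor 4. So 64 would do, and the rest is slack.
96ℚ : ℚ
96ℚ = ℕ→ℚ 96

-- e is the mixing error relative to ν d, κ bounds |A z|² / (ν d²), and all other losses are of order Ω.
module Parameters (k′ : ℕ) (ε : ℚ) (0<ε : 0ℚ < ε) (ε≤1 : ε ≤ 1ℚ) where

  open ℚ.≤-Reasoning

  abstract

    e κ Ω θ : ℚ
    -- `e = ε / 8`, since the total error `τ + 2 e` is at most `4 e` relative to `d ν`, and passing
    -- from `d^k` to `ν` costs a factor `2^k`. `κ` takes half of `e²` and leaves the other half to
    -- `2 τ`.
    e = ½ * (½ * (½ * ε))
    κ = ½ * (e * e)
    -- `Ω` is a fixed fraction of `κ^k` because `κ-power` weighs the losses against `(κ d²)^k`.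
    -- Dividing by `k` to get `θ` lets Bernoulli's inequality turn `(1 - θ)^k` into `1 - Ω`.
    Ω = 1/suc 95 * κ ^ℚ suc k′
    θ = 1/suc k′ * Ω

    0≤½ : 0ℚ ≤ ½
    0≤½ = ℚ.nonNegative⁻¹ ½

    0<½ : 0ℚ < ½
    0<½ = ℚ.positive⁻¹ ½

    0<e : 0ℚ < e
    0<e = 0<* 0<½ (0<* 0<½ (0<* 0<½ 0<ε))

    0≤e : 0ℚ ≤ e
    0≤e = ℚ.<⇒≤ 0<e

    halve : ∀ {x} → 0ℚ ≤ x → ½ * x ≤ x
    halve {x} 0≤x = ≤-from-slack (0≤* 0≤½ 0≤x) (slack x)
      where
      slack : ∀ x → x - ½ * x ≡ ½ * x
      slack = solve-∀ ring

    e≤1 : e ≤ 1ℚ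
    e≤1 = begin
      ½ * (½ * (½ * ε))   ≤⟨ halve (0≤* 0≤½ (0≤* 0≤½ 0≤ε)) ⟩
      ½ * (½ * ε)         ≤⟨ halve (0≤* 0≤½ 0≤ε) ⟩
      ½ * ε               ≤⟨ halve 0≤ε ⟩
      ε                   ≤⟨ ε≤1 ⟩
      1ℚ                  ∎
      where
      0≤ε : 0ℚ ≤ ε
      0≤ε = ℚ.<⇒≤ 0<ε

    0<κ : 0ℚ < κ
    0<κ = 0<* 0<½ (0<* 0<e 0<e)

    0≤κ : 0ℚ ≤ κ
    0≤κ = ℚ.<⇒≤ 0<κ

    κ≤e : κ ≤ e
    κ≤e = begin
      ½ * (e * e)    ≤⟨ halve (0≤* 0≤e 0≤e) ⟩
      e * e          ≤⟨ *-monoˡ 0≤e e≤1 ⟩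
      e * 1ℚ         ≡⟨ ℚ.*-identityʳ e ⟩
      e              ∎

    κ≤1 : κ ≤ 1ℚ
    κ≤1 = ℚ.≤-trans κ≤e e≤1

    0<Ω : 0ℚ < Ω
    0<Ω = 0<* (0<1/suc 95) (^-pos (suc k′) 0<κ)

    0≤Ω : 0ℚ ≤ Ω
    0≤Ω = ℚ.<⇒≤ 0<Ω

    96Ω≡κ^k : 96ℚ * Ω ≡ κ ^ℚ suc k′
    96Ω≡κ^k = suc-*-1/suc 95 (κ ^ℚ suc k′)

    96Ω≤κ : 96ℚ * Ω ≤ κ
    96Ω≤κ = begin
      96ℚ * Ω        ≡⟨ 96Ω≡κ^k ⟩
      κ * κ ^ℚ k′    ≤⟨ *-monoˡ 0≤κ (^-≤1 k′ 0≤κ κ≤1) ⟩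
      κ * 1ℚ         ≡⟨ ℚ.*-identityʳ κ ⟩
      κ              ∎

    96Ω≤1 : 96ℚ * Ω ≤ 1ℚ
    96Ω≤1 = ℚ.≤-trans 96Ω≤κ κ≤1

    Ω≤1 : Ω ≤ 1ℚ
    Ω≤1 = ℚ.≤-trans (≤-from-slack (0≤* (ℚ.nonNegative⁻¹ (96ℚ - 1ℚ)) 0≤Ω) (slack Ω)) 96Ω≤1
      where
      slack : ∀ x → 96ℚ * x - x ≡ (96ℚ - 1ℚ) * x
      slack = solve-∀ ring

    0<θ : 0ℚ < θ
    0<θ = 0<* (0<1/suc k′) 0<Ω

    0≤θ : 0ℚ ≤ θ
    0≤θ = ℚ.<⇒≤ 0<θ

    kθ≡Ω : ℕ→ℚ (suc k′) * θ ≡ Ω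
    kθ≡Ω = suc-*-1/suc k′ Ω

    θ≤Ω : θ ≤ Ω
    θ≤Ω = begin
      θ                    ≡⟨ ℚ.*-identityˡ θ ⟨
      1ℚ * θ               ≤⟨ *-monoʳ 0≤θ (fromℕ-mono {1} {suc k′} (s≤s z≤n)) ⟩
      ℕ→ℚ (suc k′) * θ     ≡⟨ kθ≡Ω ⟩
      Ω                    ∎

    θ<1 : θ < 1ℚ
    θ<1 = ℚ.≤-<-trans θ≤Ω (ℚ.<-≤-trans (subst₂ _<_ (ℚ.+-identityʳ Ω) (slack Ω) (ℚ.+-monoʳ-< Ω (0<* (ℚ.positive⁻¹ (ℕ→ℚ 95)) 0<Ω))) 96Ω≤1)
      where
      slack : ∀ x → x + ℕ→ℚ 95 * x ≡ 96ℚ * x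
      slack = solve-∀ ring

    κ+κ≡e² : κ + κ ≡ e * e
    κ+κ≡e² = double (e * e)
      where
      double : ∀ x → ½ * x + ½ * x ≡ x
      double = solve-∀ ring

    ½ε≡4e : ½ * ε ≡ 2ℚ * (2ℚ * e)
    ½ε≡4e = quadruple ε
      where
      quadruple : ∀ ε → ½ * ε ≡ 2ℚ * (2ℚ * (½ * (½ * (½ * ε))))
      quadruple = solve-∀ ring

  τ : ℚ
  τ = 2ℚ * (2ℚ * θ)

  0≤τ : 0ℚ ≤ τ
  0≤τ = 0≤* (ℚ.nonNegative⁻¹ 2ℚ) (0≤* (ℚ.nonNegative⁻¹ 2ℚ) 0≤θ)

  2τ≤κ : 2ℚ * τ ≤ κ
  2τ≤κ = ℚ.≤-trans (≤-from-slack (0≤+ (0≤* (ℚ.nonNegative⁻¹ 8ℚ) (≤⇒0≤- θ≤Ω)) (0≤* (ℚ.nonNegative⁻¹ (96ℚ - 8ℚ)) 0≤Ω)) (slack θ Ω)) 96Ω≤κ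
    where
    8ℚ = ℕ→ℚ 8
    slack : ∀ θ Ω → 96ℚ * Ω - 2ℚ * (2ℚ * (2ℚ * θ)) ≡ ℕ→ℚ 8 * (Ω - θ) + (96ℚ - ℕ→ℚ 8) * Ω
    slack = solve-∀ ring

  τ≤2τ : τ ≤ 2ℚ * τ
  τ≤2τ = ≤-from-slack 0≤τ (slack τ)
    where
    slack : ∀ x → 2ℚ * x - x ≡ x
    slack = solve-∀ ring

  τ≤1 : τ ≤ 1ℚ
  τ≤1 = ℚ.≤-trans τ≤2τ (ℚ.≤-trans 2τ≤κ κ≤1)

  e-large : κ + 2ℚ * τ ≤ e * e
  e-large = begin
    κ + 2ℚ * τ    ≤⟨ ℚ.+-monoʳ-≤ κ 2τ≤κ ⟩
    κ + κ         ≡⟨ κ+κ≡e² ⟩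
    e * e         ∎

  K m₀ : ℕ
  0<½θ^k : 0ℚ < (½ * θ) ^ℚ suc k′
  0<½θ^k = ^-pos (suc k′) (0<* 0<½ 0<θ)
  -- With `q ≥ ½ θ d` and `d^k ≥ ½ ν`, the constant 3 gives `K q^k ≥ (3/2) ν`, which exceeds `n`.
  K  = proj₁ (multiple≥ 0<½θ^k 3ℚ)
  m₁ m₂ : ℕ
  -- Lower bounds for `d`: `m₁` gives `θ d ≥ 2`, so that rounding `θ d` down to `q` loses at most
  -- half of it, and `m₂` makes the backtracking walks at most `Ω ν`.
  m₁ = proj₁ (multiple≥ 0<θ 2ℚ)
  m₂ = proj₁ (multiple≥ 0<Ω (2ℚ ^ℚ suc k′ * (ℕ→ℚ (suc k′) * ℕ→ℚ K ^ℚ k′)))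
  m₀ = m₁ ℕ.+ m₂

  K-large : 3ℚ ≤ ℕ→ℚ K * (½ * θ) ^ℚ suc k′
  K-large = proj₂ (multiple≥ 0<½θ^k 3ℚ)

  m₀θ≥2 : 2ℚ ≤ ℕ→ℚ m₀ * θ
  m₀θ≥2 = ℚ.≤-trans (proj₂ (multiple≥ 0<θ 2ℚ)) (*-monoʳ 0≤θ (fromℕ-mono (ℕ.m≤m+n m₁ m₂)))

  m₀Ω-large : 2ℚ ^ℚ suc k′ * (ℕ→ℚ (suc k′) * ℕ→ℚ K ^ℚ k′) ≤ ℕ→ℚ m₀ * Ω
  m₀Ω-large = ℚ.≤-trans (proj₂ (multiple≥ 0<Ω (2ℚ ^ℚ suc k′ * (ℕ→ℚ (suc k′) * ℕ→ℚ K ^ℚ k′)))) (*-monoʳ 0≤Ω (fromℕ-mono (ℕ.m≤n+m m₂ m₁)))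

  -- Since `d^k ≥ ½ n`, this many vertices force `d ≥ m₀`; the successor keeps `n` positive.
  order : ℕ
  order = suc (2 ℕ.* m₀ ℕ.^ suc k′)

  module Estimates {n} (G : Graph n) (free : CycleFree (suc k′) G) (order≤n : order ℕ.≤ n)
    (ν inv d : ℚ) (ν≡n : ν ≡ ℕ→ℚ n) (inv*ν : inv * ν ≡ 1ℚ) (0≤inv : 0ℚ ≤ inv) (0≤d : 0ℚ ≤ d)
    (total : ℕ→ℚ (edges G everything everything) ≡ ν * d)
    (d-lower : (1ℚ - θ) ^ℚ suc k′ * ν ≤ d ^ℚ suc k′)
    (d-upper : d ^ℚ suc k′ ≤ (1ℚ + θ) ^ℚ suc k′ * ν)
    where

    0<ν : 0ℚ < ν
    0<ν = subst (0ℚ <_) (≡-sym ν≡n) (ℚ.<-≤-trans 0<1 (fromℕ-mono {1} {n} (ℕ.≤-trans (s≤s z≤n) order≤n)))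

    0≤ν : 0ℚ ≤ ν
    0≤ν = ℚ.<⇒≤ 0<ν

    dᵏ : ℚ
    dᵏ = d ^ℚ suc k′

    dᵏ≥ : (1ℚ - Ω) * ν ≤ dᵏ
    dᵏ≥ = begin
      (1ℚ - Ω) * ν                      ≡⟨ cong (λ t → (1ℚ - t) * ν) kθ≡Ω ⟨
      (1ℚ - ℕ→ℚ (suc k′) * θ) * ν       ≤⟨ *-monoʳ 0≤ν (1-k*δ≤[1-δ]^k (suc k′) 0≤θ (ℚ.≤-trans θ≤Ω Ω≤1)) ⟩
      (1ℚ - θ) ^ℚ suc k′ * ν            ≤⟨ d-lower ⟩
      dᵏ                                ∎

    dᵏ≤ : dᵏ ≤ 2ℚ ^ℚ suc k′ * ν
    dᵏ≤ = ℚ.≤-trans d-upper (*-monoʳ 0≤ν (^-mono (suc k′) (0≤+ 0≤1 0≤θ) (ℚ.+-monoʳ-≤ 1ℚ (ℚ.≤-trans θ≤Ω Ω≤1))))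

    ½≤1-Ω : ½ ≤ 1ℚ - Ω
    ½≤1-Ω = ≤-from-slack (0≤+ (0≤* 0≤½ (≤⇒0≤- 96Ω≤1)) (0≤* (ℚ.nonNegative⁻¹ (ℕ→ℚ 47)) 0≤Ω)) (slack Ω)
      where
      slack : ∀ Ω → 1ℚ - Ω - ½ ≡ ½ * (1ℚ - 96ℚ * Ω) + ℕ→ℚ 47 * Ω
      slack = solve-∀ ring

    ½ν≤dᵏ : ½ * ν ≤ dᵏ
    ½ν≤dᵏ = ℚ.≤-trans (*-monoʳ 0≤ν ½≤1-Ω) dᵏ≥

    m₀≤d : ℕ→ℚ m₀ ≤ d
    m₀≤d = ^-cancel-≤ k′ 0≤d (begin
      ℕ→ℚ m₀ ^ℚ suc k′                ≡⟨ fromℕ-^ m₀ (suc k′) ⟨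
      ℕ→ℚ (m₀ ℕ.^ suc k′)             ≡⟨ half (ℕ→ℚ (m₀ ℕ.^ suc k′)) ⟨
      ½ * (2ℚ * ℕ→ℚ (m₀ ℕ.^ suc k′))  ≡⟨ cong (½ *_) (fromℕ-* 2 (m₀ ℕ.^ suc k′)) ⟨
      ½ * ℕ→ℚ (2 ℕ.* m₀ ℕ.^ suc k′)   ≤⟨ *-monoˡ 0≤½ (fromℕ-mono (ℕ.≤-trans (ℕ.n≤1+n (2 ℕ.* m₀ ℕ.^ suc k′)) order≤n)) ⟩
      ½ * ℕ→ℚ n                       ≡⟨ cong (½ *_) ν≡n ⟨
      ½ * ν                           ≤⟨ ½ν≤dᵏ ⟩
      dᵏ                              ∎)
      where
      half : ∀ x → ½ * (2ℚ * x) ≡ x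
      half = solve-∀ ring

    2≤θd : 2ℚ ≤ θ * d
    2≤θd = begin
      2ℚ             ≤⟨ m₀θ≥2 ⟩
      ℕ→ℚ m₀ * θ     ≤⟨ *-monoʳ 0≤θ m₀≤d ⟩
      d * θ          ≡⟨ ℚ.*-comm d θ ⟩
      θ * d          ∎

    0<d : 0ℚ < d
    0<d with d ℚ.≤? 0ℚ
    ... | no  d≰0 = ℚ.≰⇒> d≰0
    ... | yes d≤0 = contradiction (ℚ.<-≤-trans (ℚ.positive⁻¹ 2ℚ) (ℚ.≤-trans 2≤θd
                      (ℚ.≤-trans (*-monoˡ 0≤θ d≤0) (ℚ.≤-reflexive (ℚ.*-zeroʳ θ))))) (ℚ.<-irrefl refl)

    q : ℕ
    q = proj₁ (floor-bounds (θ * d) (0≤* 0≤θ 0≤d))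

    q≤θd : ℕ→ℚ q ≤ θ * d
    q≤θd = proj₁ (proj₂ (floor-bounds (θ * d) (0≤* 0≤θ 0≤d)))

    ½θd≤q : ½ * θ * d ≤ ℕ→ℚ q
    ½θd≤q = ≤-from-slack (0≤+ (≤⇒0≤- (proj₂ (proj₂ (floor-bounds (θ * d) (0≤* 0≤θ 0≤d))))) (0≤* 0≤½ (≤⇒0≤- 2≤θd))) (slack θ d (ℕ→ℚ q))
      where
      slack : ∀ θ d q → q - ½ * θ * d ≡ (q + 1ℚ - θ * d) + ½ * (θ * d - 2ℚ)
      slack = solve-∀ ring

    n<Kq^k : n ℕ.< K ℕ.* q ℕ.^ suc k′
    n<Kq^k = fromℕ-cancel-< (begin-strict
      ℕ→ℚ n                                        ≡⟨ ν≡n ⟨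
      ν                                            ≡⟨ ℚ.+-identityʳ ν ⟨
      ν + 0ℚ                                       <⟨ ℚ.+-monoʳ-< ν (0<* 0<½ 0<ν) ⟩
      ν + ½ * ν                                    ≡⟨ rearrange ν ⟩
      3ℚ * (½ * ν)                                 ≤⟨ *-mono-≤ (ℚ.nonNegative⁻¹ 3ℚ) (0≤* 0≤½ 0≤ν) K-large ½ν≤dᵏ ⟩
      ℕ→ℚ K * (½ * θ) ^ℚ suc k′ * d ^ℚ suc k′      ≡⟨ ℚ.*-assoc (ℕ→ℚ K) ((½ * θ) ^ℚ suc k′) dᵏ ⟩
      ℕ→ℚ K * ((½ * θ) ^ℚ suc k′ * d ^ℚ suc k′)    ≡⟨ cong (ℕ→ℚ K *_) (^-distrib-* (½ * θ) d (suc k′)) ⟨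
      ℕ→ℚ K * (½ * θ * d) ^ℚ suc k′                ≤⟨ *-monoˡ (0≤fromℕ K) (^-mono (suc k′) (0≤* (0≤* 0≤½ 0≤θ) 0≤d) ½θd≤q) ⟩
      ℕ→ℚ K * ℕ→ℚ q ^ℚ suc k′                      ≡⟨ trans (fromℕ-* K (q ℕ.^ suc k′)) (cong (ℕ→ℚ K *_) (fromℕ-^ q (suc k′))) ⟨
      ℕ→ℚ (K ℕ.* q ℕ.^ suc k′)                     ∎)
      where
      rearrange : ∀ ν → ν + ½ * ν ≡ 3ℚ * (½ * ν)
      rearrange = solve-∀ ring

    0<K : 0 ℕ.< K
    0<K = proj₁ (*-pos K (q ℕ.^ suc k′) (ℕ.≤-<-trans z≤n n<Kq^k))

    -- Multiplied by `d`, the left side is a constant times `d^k`, hence a constant times `ν`. On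
    -- the right the new factor `d` is at least `m₀`, which was chosen to absorb that constant.
    backtracking-small : ℕ→ℚ (suc k′) * (ℕ→ℚ K * d) ^ℚ k′ ≤ Ω * ν
    backtracking-small = *-cancelʳ 0<d (begin
      ℕ→ℚ (suc k′) * (ℕ→ℚ K * d) ^ℚ k′ * d                         ≡⟨ cong (λ t → ℕ→ℚ (suc k′) * t * d) (^-distrib-* (ℕ→ℚ K) d k′) ⟩
      ℕ→ℚ (suc k′) * (ℕ→ℚ K ^ℚ k′ * d ^ℚ k′) * d                   ≡⟨ rearrange (ℕ→ℚ (suc k′)) (ℕ→ℚ K ^ℚ k′) (d ^ℚ k′) d ⟩
      ℕ→ℚ (suc k′) * ℕ→ℚ K ^ℚ k′ * dᵏ                              ≤⟨ *-monoˡ (0≤* (0≤fromℕ (suc k′)) (^-nonneg k′ (0≤fromℕ K))) dᵏ≤ ⟩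
      ℕ→ℚ (suc k′) * ℕ→ℚ K ^ℚ k′ * (2ℚ ^ℚ suc k′ * ν)              ≡⟨ rearrange′ (ℕ→ℚ (suc k′) * ℕ→ℚ K ^ℚ k′) (2ℚ ^ℚ suc k′) ν ⟩
      2ℚ ^ℚ suc k′ * (ℕ→ℚ (suc k′) * ℕ→ℚ K ^ℚ k′) * ν              ≤⟨ *-monoʳ 0≤ν m₀Ω-large ⟩
      ℕ→ℚ m₀ * Ω * ν                                               ≤⟨ *-monoʳ 0≤ν (*-monoʳ 0≤Ω m₀≤d) ⟩
      d * Ω * ν                                                    ≡⟨ rearrange″ d Ω ν ⟩
      Ω * ν * d                                                    ∎)
      where
      rearrange : ∀ a b c d → a * (b * c) * d ≡ a * b * (d * c)
      rearrange = solve-∀ ring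
      rearrange′ : ∀ a b c → a * (b * c) ≡ b * a * c
      rearrange′ = solve-∀ ring
      rearrange″ : ∀ a b c → a * b * c ≡ b * c * a
      rearrange″ = solve-∀ ring

    -- `(1 - τ)^k` loses `4 Ω` and `d^k` loses `Ω` against `ν`; squaring doubles the total of `5 Ω`.
    ρ : ℚ
    ρ = ℕ→ℚ 10 * Ω

    d-power : (1ℚ - ρ) * (ν * ν) ≤ ((1ℚ - τ) * d * ((1ℚ - τ) * d)) ^ℚ suc k′
    d-power = begin
      (1ℚ - ρ) * (ν * ν)                                ≤⟨ ≤-from-slack (0≤* (0≤* (ℚ.nonNegative⁻¹ (ℕ→ℚ 25)) (0≤² Ω)) (0≤² ν)) (slack Ω ν) ⟩
      (1ℚ - ℕ→ℚ 5 * Ω) * ν * ((1ℚ - ℕ→ℚ 5 * Ω) * ν)     ≤⟨ *-mono-≤ 0≤y 0≤y y≤ y≤ ⟩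
      x ^ℚ suc k′ * x ^ℚ suc k′                         ≡⟨ ^-distrib-* x x (suc k′) ⟨
      (x * x) ^ℚ suc k′                                 ∎
      where
      x = (1ℚ - τ) * d
      slack : ∀ Ω ν → (1ℚ - ℕ→ℚ 5 * Ω) * ν * ((1ℚ - ℕ→ℚ 5 * Ω) * ν) - (1ℚ - ℕ→ℚ 10 * Ω) * (ν * ν) ≡ ℕ→ℚ 25 * (Ω * Ω) * (ν * ν)
      slack = solve-∀ ring
      slack′ : ∀ Ω → 1ℚ - ℕ→ℚ 5 * Ω ≡ (1ℚ - 96ℚ * Ω) + ℕ→ℚ 91 * Ω
      slack′ = solve-∀ ring
      0≤y : 0ℚ ≤ (1ℚ - ℕ→ℚ 5 * Ω) * ν
      0≤y = 0≤* (subst (0ℚ ≤_) (≡-sym (slack′ Ω)) (0≤+ (≤⇒0≤- 96Ω≤1) (0≤* (ℚ.nonNegative⁻¹ (ℕ→ℚ 91)) 0≤Ω))) 0≤ν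
      kτ : ∀ k θ → k * (2ℚ * (2ℚ * θ)) ≡ ℕ→ℚ 4 * (k * θ)
      kτ = solve-∀ ring
      slack″ : ∀ Ω ν → (1ℚ - ℕ→ℚ 4 * Ω) * ((1ℚ - Ω) * ν) - (1ℚ - ℕ→ℚ 5 * Ω) * ν ≡ ℕ→ℚ 4 * (Ω * Ω) * ν
      slack″ = solve-∀ ring
      y≤ : (1ℚ - ℕ→ℚ 5 * Ω) * ν ≤ x ^ℚ suc k′
      y≤ = begin
        (1ℚ - ℕ→ℚ 5 * Ω) * ν                             ≤⟨ ≤-from-slack (0≤* (0≤* (ℚ.nonNegative⁻¹ (ℕ→ℚ 4)) (0≤² Ω)) 0≤ν) (slack″ Ω ν) ⟩
        (1ℚ - ℕ→ℚ 4 * Ω) * ((1ℚ - Ω) * ν)                ≡⟨ cong (λ t → (1ℚ - ℕ→ℚ 4 * t) * ((1ℚ - Ω) * ν)) kθ≡Ω ⟨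
        (1ℚ - ℕ→ℚ 4 * (ℕ→ℚ (suc k′) * θ)) * ((1ℚ - Ω) * ν) ≡⟨ cong (λ t → (1ℚ - t) * ((1ℚ - Ω) * ν)) (kτ (ℕ→ℚ (suc k′)) θ) ⟨
        (1ℚ - ℕ→ℚ (suc k′) * τ) * ((1ℚ - Ω) * ν)         ≤⟨ *-monoʳ (0≤* (≤⇒0≤- Ω≤1) 0≤ν) (1-k*δ≤[1-δ]^k (suc k′) 0≤τ τ≤1) ⟩
        (1ℚ - τ) ^ℚ suc k′ * ((1ℚ - Ω) * ν)              ≤⟨ *-monoˡ (^-nonneg (suc k′) (≤⇒0≤- τ≤1)) dᵏ≥ ⟩
        (1ℚ - τ) ^ℚ suc k′ * dᵏ                          ≡⟨ ^-distrib-* (1ℚ - τ) d (suc k′) ⟨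
        x ^ℚ suc k′                                      ∎

    κ-power : (ρ + (3ℚ * Ω + 3ℚ * Ω)) * (ν * ν) ≤ (κ * (d * d)) ^ℚ suc k′
    κ-power = begin
      (ρ + (3ℚ * Ω + 3ℚ * Ω)) * (ν * ν)          ≤⟨ ≤-from-slack (0≤* (0≤* (ℚ.nonNegative⁻¹ (ℕ→ℚ 8)) 0≤Ω) (0≤² ν)) (slack Ω ν) ⟩
      96ℚ * Ω * (½ * ν * (½ * ν))                ≤⟨ *-monoˡ (0≤* (ℚ.nonNegative⁻¹ 96ℚ) 0≤Ω) (*-mono-≤ (0≤* 0≤½ 0≤ν) (0≤* 0≤½ 0≤ν) ½ν≤dᵏ ½ν≤dᵏ) ⟩
      96ℚ * Ω * (dᵏ * dᵏ)                        ≡⟨ cong₂ _*_ 96Ω≡κ^k (≡-sym (^-distrib-* d d (suc k′))) ⟩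
      κ ^ℚ suc k′ * (d * d) ^ℚ suc k′            ≡⟨ ^-distrib-* κ (d * d) (suc k′) ⟨
      (κ * (d * d)) ^ℚ suc k′                    ∎
      where
      slack : ∀ Ω ν → 96ℚ * Ω * (½ * ν * (½ * ν)) - (ℕ→ℚ 10 * Ω + (3ℚ * Ω + 3ℚ * Ω)) * (ν * ν) ≡ ℕ→ℚ 8 * Ω * (ν * ν)
      slack = solve-∀ ring

    -- Replacing `(1 + κ)^k` by `1 + κ` is affordable, because `κ` is at least `96 Ω` while the
    -- losses to be covered are only a few multiples of `Ω`.
    1+κ-power : (1ℚ + 3ℚ * Ω) * (ν * ν) ≤ ((1ℚ + κ) * (d * d)) ^ℚ suc k′
    1+κ-power = begin
      (1ℚ + 3ℚ * Ω) * (ν * ν)                          ≤⟨ *-monoʳ (0≤² ν) factor≤ ⟩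
      (1ℚ + κ) * ((1ℚ - Ω) * (1ℚ - Ω)) * (ν * ν)       ≡⟨ rearrange (1ℚ + κ) (1ℚ - Ω) ν ⟩
      (1ℚ + κ) * ((1ℚ - Ω) * ν * ((1ℚ - Ω) * ν))       ≤⟨ *-mono-≤ (0≤+ 0≤1 0≤κ) (0≤² ((1ℚ - Ω) * ν)) 1+κ≤ (*-mono-≤ 0≤y 0≤y dᵏ≥ dᵏ≥) ⟩
      (1ℚ + κ) ^ℚ suc k′ * (dᵏ * dᵏ)                   ≡⟨ cong ((1ℚ + κ) ^ℚ suc k′ *_) (^-distrib-* d d (suc k′)) ⟨
      (1ℚ + κ) ^ℚ suc k′ * (d * d) ^ℚ suc k′           ≡⟨ ^-distrib-* (1ℚ + κ) (d * d) (suc k′) ⟨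
      ((1ℚ + κ) * (d * d)) ^ℚ suc k′                   ∎
      where
      0≤y : 0ℚ ≤ (1ℚ - Ω) * ν
      0≤y = 0≤* (≤⇒0≤- Ω≤1) 0≤ν
      slack : ∀ κ Ω → (1ℚ + κ) * ((1ℚ - Ω) * (1ℚ - Ω)) - (1ℚ + 3ℚ * Ω)
        ≡ (κ - 96ℚ * Ω) + ℕ→ℚ 89 * Ω + 2ℚ * Ω * (1ℚ - κ) + (1ℚ + κ) * (Ω * Ω)
      slack = solve-∀ ring
      factor≤ : 1ℚ + 3ℚ * Ω ≤ (1ℚ + κ) * ((1ℚ - Ω) * (1ℚ - Ω))
      factor≤ = ≤-from-slack
        (0≤+ (0≤+ (0≤+ (≤⇒0≤- 96Ω≤κ) (0≤* (ℚ.nonNegative⁻¹ (ℕ→ℚ 89)) 0≤Ω))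
          (0≤* (0≤* (ℚ.nonNegative⁻¹ 2ℚ) 0≤Ω) (≤⇒0≤- κ≤1))) (0≤* (0≤+ 0≤1 0≤κ) (0≤² Ω))) (slack κ Ω)
      rearrange : ∀ a b ν → a * (b * b) * (ν * ν) ≡ a * (b * ν * (b * ν))
      rearrange = solve-∀ ring
      1≤1+κ : 1ℚ ≤ 1ℚ + κ
      1≤1+κ = subst (_≤ 1ℚ + κ) (ℚ.+-identityʳ 1ℚ) (ℚ.+-monoʳ-≤ 1ℚ 0≤κ)
      1+κ≤ : 1ℚ + κ ≤ (1ℚ + κ) ^ℚ suc k′
      1+κ≤ = begin
        1ℚ + κ                     ≡⟨ ℚ.*-identityʳ (1ℚ + κ) ⟨
        (1ℚ + κ) * 1ℚ              ≤⟨ *-monoˡ (0≤+ 0≤1 0≤κ) (subst (_≤ (1ℚ + κ) ^ℚ k′) (1^ k′) (^-mono k′ 0≤1 1≤1+κ)) ⟩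
        (1ℚ + κ) ^ℚ suc k′         ∎

    open Truncation G k′ free ν inv d ν≡n 0<ν inv*ν 0≤inv 0≤d total K q 0<K n<Kq^k
      θ τ Ω κ ρ e 0≤θ 0≤κ 0≤e 0≤Ω Ω≤1 q≤θd backtracking-small refl τ≤1 d-power κ-power 1+κ-power e-large
      using (edge-discrepancy)

    discrepancy-power : ∀ A B →
      ∣ ℕ→ℚ (edges G A B) - inv * ℕ→ℚ (size B) * (d * ℕ→ℚ (size A)) ∣ ^ℚ suc k′ ≤ ε ^ℚ suc k′ * ν ^ℚ suc (suc k′)
    discrepancy-power A B = begin
      X ^ℚ suc k′                                       ≤⟨ ^-mono (suc k′) (ℚ.0≤∣p∣ (ℕ→ℚ (edges G A B) - inv * ℕ→ℚ (size B) * (d * ℕ→ℚ (size A)))) (ℚ.≤-trans (edge-discrepancy A B) total-error) ⟩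
      (½ * ε * (d * ν)) ^ℚ suc k′                       ≡⟨ ^-distrib-* (½ * ε) (d * ν) (suc k′) ⟩
      (½ * ε) ^ℚ suc k′ * (d * ν) ^ℚ suc k′             ≡⟨ cong ((½ * ε) ^ℚ suc k′ *_) (^-distrib-* d ν (suc k′)) ⟩
      (½ * ε) ^ℚ suc k′ * (dᵏ * ν ^ℚ suc k′)            ≤⟨ *-monoˡ (^-nonneg (suc k′) (0≤* 0≤½ (ℚ.<⇒≤ 0<ε))) (*-monoʳ (^-nonneg (suc k′) 0≤ν) dᵏ≤) ⟩
      (½ * ε) ^ℚ suc k′ * (2ℚ ^ℚ suc k′ * ν * ν ^ℚ suc k′) ≡⟨ rearrange ((½ * ε) ^ℚ suc k′) (2ℚ ^ℚ suc k′) ν (ν ^ℚ suc k′) ⟩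
      (½ * ε) ^ℚ suc k′ * 2ℚ ^ℚ suc k′ * (ν * ν ^ℚ suc k′) ≡⟨ cong (_* (ν * ν ^ℚ suc k′)) (trans (≡-sym (^-distrib-* (½ * ε) 2ℚ (suc k′))) (cong (_^ℚ suc k′) (half ε))) ⟩
      ε ^ℚ suc k′ * ν ^ℚ suc (suc k′)                   ∎
      where
      X = ∣ ℕ→ℚ (edges G A B) - inv * ℕ→ℚ (size B) * (d * ℕ→ℚ (size A)) ∣
      rearrange : ∀ a b ν p → a * (b * ν * p) ≡ a * b * (ν * p)
      rearrange = solve-∀ ring
      half : ∀ x → ½ * x * 2ℚ ≡ x
      half = solve-∀ ring
      slack : ∀ e τ d ν → 2ℚ * (2ℚ * e) * (d * ν) - (τ * (ν * d) + 2ℚ * (e * (d * ν))) ≡ (e + (e - τ)) * (d * ν)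
      slack = solve-∀ ring
      total-error : τ * (ν * d) + 2ℚ * (e * (d * ν)) ≤ ½ * ε * (d * ν)
      total-error = subst (λ t → τ * (ν * d) + 2ℚ * (e * (d * ν)) ≤ t * (d * ν)) (≡-sym ½ε≡4e)
        (≤-from-slack (0≤* (0≤+ 0≤e (≤⇒0≤- (ℚ.≤-trans τ≤2τ (ℚ.≤-trans 2τ≤κ κ≤e)))) (0≤* 0≤d 0≤ν)) (slack e τ d ν))

-- From the estimate for fixed parameters to the limit statement

eG≡edges : ∀ (G : Graph n) S T → eG G S T ≡ edges G (lookup S) (lookup T)
eG≡edges {n} G S T = trans
  (Σv-cong n λ s → Σv-cong n λ t → ℕ.*-assoc (b2n (lookup S s)) (b2n (lookup T t)) (b2n (adj G s t)))
  (≡-sym (edges-flat G (lookup S) (lookup T)))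

edges-everything : ∀ (G : Graph n) → eG G (replicate n true) (replicate n true) ≡ edges G everything everything
edges-everything {n} G = trans (eG≡edges G (replicate n true) (replicate n true)) (Σv-cong n λ v →
  cong₂ ℕ._*_ (cong b2n (lookup-replicate v true)) (Σv-cong n λ w → cong (λ b → b2n b ℕ.* b2n (adj G v w)) (lookup-replicate w true)))

module _ (k′ : ℕ) (ε : ℚ) (0<ε : 0ℚ < ε) (ε≤1 : ε ≤ 1ℚ) where

  open Parameters k′ ε 0<ε ε≤1 using (θ; order; module Estimates)

  avgDeg-discrepancy : ∀ {n} (G : Graph n) → CycleFree (suc k′) G → order ℕ.≤ n →
    (1ℚ - θ) ^ℚ suc k′ * ℕ→ℚ n ≤ avgDeg G ^ℚ suc k′ →
    avgDeg G ^ℚ suc k′ ≤ (1ℚ + θ) ^ℚ suc k′ * ℕ→ℚ n → ∀ (S T : Subset n) →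
    ∣ ℕ→ℚ (eG G S T) - ((avgDeg G * ℕ→ℚ (card S) * ℕ→ℚ (card T)) /ℕ n) ∣ ^ℚ suc k′ ≤ ε ^ℚ suc k′ * ℕ→ℚ n ^ℚ suc (suc k′)
  avgDeg-discrepancy {zero} G free () lower upper S T
  avgDeg-discrepancy {suc m} G free order≤n lower upper S T =
    subst (λ t → ∣ t ∣ ^ℚ suc k′ ≤ ε ^ℚ suc k′ * ν ^ℚ suc (suc k′))
      (cong₂ _-_ (cong ℕ→ℚ (≡-sym (eG≡edges G S T))) (rearrange inv (ℕ→ℚ (card T)) d (ℕ→ℚ (card S))))
      (Estimates.discrepancy-power G free order≤n ν inv d refl (1/suc-* m) 0≤inv 0≤d total lower upper (lookup S) (lookup T))
    where
    ν inv d : ℚ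
    ν = ℕ→ℚ (suc m)
    inv = 1/suc m
    d = avgDeg G
    0≤inv : 0ℚ ≤ inv
    0≤inv = ℚ.<⇒≤ (0<1/suc m)
    edgeCount : ℕ
    edgeCount = eG G (replicate (suc m) true) (replicate (suc m) true)
    0≤d : 0ℚ ≤ d
    0≤d = 0≤* (0≤fromℕ edgeCount) 0≤inv
    rearrange : ∀ i t d s → i * t * (d * s) ≡ d * s * t * i
    rearrange = solve-∀ ring
    swap : ∀ ν x i → ν * (x * i) ≡ x * (i * ν)
    swap = solve-∀ ring
    total : ℕ→ℚ (edges G everything everything) ≡ ν * d
    total = begin
      ℕ→ℚ (edges G everything everything)    ≡⟨ cong ℕ→ℚ (edges-everything G) ⟨
      ℕ→ℚ edgeCount                          ≡⟨ ℚ.*-identityʳ (ℕ→ℚ edgeCount) ⟨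
      ℕ→ℚ edgeCount * 1ℚ                     ≡⟨ cong (ℕ→ℚ edgeCount *_) (1/suc-* m) ⟨
      ℕ→ℚ edgeCount * (inv * ν)              ≡⟨ swap ν (ℕ→ℚ edgeCount) inv ⟨
      ν * d                                  ∎
      where open ≡-Reasoning

-- The parameters ask for `ε ≤ 1`. The error bound grows with `ε`, so a large `ε` may be replaced by
-- 1.
positive-below : ∀ ε → 0ℚ < ε → ∃ λ ε′ → 0ℚ < ε′ × ε′ ≤ 1ℚ × ε′ ≤ ε
positive-below ε 0<ε with ℚ.≤-total ε 1ℚ
... | inj₁ ε≤1 = ε , 0<ε , ε≤1 , ℚ.≤-refl
... | inj₂ 1≤ε = 1ℚ , 0<1 , ℚ.≤-refl , 1≤ε

theorem5p8 : (k : ℕ) → 2 ℕ.≤ k →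
    (N : ℕ → ℕ) → (G : (m : ℕ) → Graph (N m)) →
    (∀ m → CycleFree k (G m)) →
    (∀ B → Σ ℕ λ M → ∀ m → M ℕ.≤ m → B ℕ.≤ N m) →
    (∀ δ → 0ℚ < δ → δ < 1ℚ → Σ ℕ λ M → ∀ m → M ℕ.≤ m →
    ((1ℚ - δ) ^ℚ k) * ℕ→ℚ (N m) ≤ avgDeg (G m) ^ℚ k
    × avgDeg (G m) ^ℚ k ≤ ((1ℚ + δ) ^ℚ k) * ℕ→ℚ (N m)) →
    ∀ ε → 0ℚ < ε → Σ ℕ λ M → ∀ m → M ℕ.≤ m → (S T : Subset (N m)) →
    ∣ ℕ→ℚ (eG (G m) S T) - ((avgDeg (G m) * ℕ→ℚ (card S) * ℕ→ℚ (card T)) /ℕ N m) ∣ ^ℚ k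
    ≤ (ε ^ℚ k) * (ℕ→ℚ (N m) ^ℚ (ℕ.suc k))
theorem5p8 (suc k′) _ N G free N→∞ degree ε 0<ε = shrink (positive-below ε 0<ε)
  where
  shrink : (∃ λ ε′ → 0ℚ < ε′ × ε′ ≤ 1ℚ × ε′ ≤ ε) → _
  shrink (ε′ , 0<ε′ , ε′≤1 , ε′≤ε) = M₁ ℕ.⊔ M₂ , λ m M≤m S T → ℚ.≤-trans
    (avgDeg-discrepancy k′ ε′ 0<ε′ ε′≤1 (G m) (free m) (large m (ℕ.≤-trans (ℕ.m≤m⊔n M₁ M₂) M≤m))
      (proj₁ (near m (ℕ.≤-trans (ℕ.m≤n⊔m M₁ M₂) M≤m))) (proj₂ (near m (ℕ.≤-trans (ℕ.m≤n⊔m M₁ M₂) M≤m))) S T)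
    (*-monoʳ (^-nonneg (suc (suc k′)) (0≤fromℕ (N m))) (^-mono (suc k′) (ℚ.<⇒≤ 0<ε′) ε′≤ε))
    where
    open Parameters k′ ε′ 0<ε′ ε′≤1 using (θ; order; 0<θ; θ<1)
    M₁ M₂ : ℕ
    M₁ = proj₁ (N→∞ order)
    M₂ = proj₁ (degree θ 0<θ θ<1)
    large : ∀ m → M₁ ℕ.≤ m → order ℕ.≤ N m
    large = proj₂ (N→∞ order)
    near : ∀ m → M₂ ℕ.≤ m →
      (1ℚ - θ) ^ℚ suc k′ * ℕ→ℚ (N m) ≤ avgDeg (G m) ^ℚ suc k′ ×
      avgDeg (G m) ^ℚ suc k′ ≤ (1ℚ + θ) ^ℚ suc k′ * ℕ→ℚ (N m)
    near = proj₂ (degree θ 0<θ θ<1)
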